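{- Let $m,n,p$ be positive integers with $mn \mid p$. Then \begin{equation*} \nu_{1}(K(p^{(1)},m^{(n)}))=\phi(m,n,p)-\frac{1}{12}m^{2}n^{2}+\frac{1}{12}p^{2}, \end{equation*} where \begin{equation*} \begin{split} \phi(m,n,p)=&\frac{1}{24}m^{4}n^{4}+\frac{1}{12}m^{2}n^{3} -\frac{1}{12}m^{4}n^{3}-\frac{1}{4}m^{3}n^{3}+\frac{1}{2}m^{3}n^{2}+\frac{1}{24}m^{4}n^{2} -\frac{1}{4}m^{3}n\\ &+\frac{1}{6}m^{2}n^{2}p^{2}-\frac{1}{4}p^{2}mn-\frac{3}{4}m^{2}n^{2}p +\frac{1}{12}mnp+\frac{1}{2}m^{2}np -\frac{1}{6}m^{3}n^{2}p\\ &+\frac{1}{6}m^{3}n^{3}p +\frac{1}{6}mn^{2}p . \end{split} \end{equation*}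
   Context: An outerplanar drawing of a graph $G$ is a drawing in which the vertices are placed on a circle and each edge is drawn as a straight line segment through the interior of the circle, with no more than two edges crossing at any single point. The outerplanar crossing number $\nu_1(G)$ is the minimum number of edge crossings over all outerplanar drawings of $G$. $K(p^{(1)},m^{(n)})$ denotes the complete multipartite graph with $n+1$ partite sets, one of which has $p$ vertices and the other $n$ of which have $m$ vertices each (two vertices are adjacent iff they lie in different partite sets). -}

module Defs where

open import Data.Nat as ℕ using (ℕ; zero; suc)
open import Data.Fin as Fin using (Fin; _<?_; _≟_)
open import Data.Product using (_×_; _,_; Σ)
open import Data.Sum using (_⊎_; inj₁; inj₂)
open import Data.Bool using (Bool; true; false; _∧_; if_then_else_; not)
open import Relation.Nullary.Decidable using (⌊_⌋)
open import Relation.Binary.PropositionalEquality using (_≡_)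
open import Function.Bundles using (_↔_; Inverse)

-- Vertices of K(p^(1), m^(n)): the partite set of size p (inj₁), and
-- n partite sets of size m each (inj₂ (a , i) = i-th vertex of the a-th set).
KVertex : ℕ → ℕ → ℕ → Set
KVertex p m n = Fin p ⊎ (Fin n × Fin m)

adj : {p m n : ℕ} → KVertex p m n → KVertex p m n → Bool
adj (inj₁ _) (inj₁ _) = false
adj (inj₁ _) (inj₂ _) = true
adj (inj₂ _) (inj₁ _) = true
adj (inj₂ (a , _)) (inj₂ (b , _)) = not ⌊ a ≟ b ⌋

order : ℕ → ℕ → ℕ → ℕ
order p m n = p ℕ.+ n ℕ.* m

-- An outerplanar drawing is determined by the cyclic placement of the vertices
-- on the circle: position k ∈ Fin (order p m n) carries vertex (to k).
OuterplanarDrawing : ℕ → ℕ → ℕ → Set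
OuterplanarDrawing p m n = Fin (order p m n) ↔ KVertex p m n

∑ : (N : ℕ) → (Fin N → ℕ) → ℕ
∑ zero f = 0
∑ (suc N) f = f Fin.zero ℕ.+ ∑ N (λ i → f (Fin.suc i))

b2n : Bool → ℕ
b2n true = 1
b2n false = 0

-- Two straight chords between points on a circle cross (in the interior)
-- iff their endpoints strictly interleave. Each crossing pair of edges
-- corresponds to exactly one quadruple of positions i < j < k < l with
-- edges {i,k} and {j,l}.
crossingsOf : {N : ℕ} {V : Set} → (V → V → Bool) → (Fin N → V) → ℕ
crossingsOf {N} e f =
  ∑ N λ i → ∑ N λ j → ∑ N λ k → ∑ N λ l →
    b2n (⌊ i <? j ⌋ ∧ ⌊ j <? k ⌋ ∧ ⌊ k <? l ⌋ ∧ e (f i) (f k) ∧ e (f j) (f l))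

crossings : {p m n : ℕ} → OuterplanarDrawing p m n → ℕ
crossings D = crossingsOf adj (Inverse.to D)

IsOuterplanarCrossingNumber : ℕ → ℕ → ℕ → ℕ → Set
IsOuterplanarCrossingNumber p m n c =
  Σ (OuterplanarDrawing p m n) (λ D → crossings D ≡ c)
  × ((D : OuterplanarDrawing p m n) → c ℕ.≤ crossings D)

-- 24 · (φ(m,n,p) − m²n²/12 + p²/12), as an integer.
module _ where
  open import Data.Integer using (ℤ; +_; _+_; _-_; _*_; _^_)

  rhs24 : ℕ → ℕ → ℕ → ℤ
  rhs24 m n p =
      ( M ^ 4 * N ^ 4 + + 2 * M ^ 2 * N ^ 3 - + 2 * M ^ 4 * N ^ 3
      - + 6 * M ^ 3 * N ^ 3 + + 12 * M ^ 3 * N ^ 2 + M ^ 4 * N ^ 2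
      - + 6 * M ^ 3 * N
      + + 4 * M ^ 2 * N ^ 2 * P ^ 2 - + 6 * P ^ 2 * M * N
      - + 18 * M ^ 2 * N ^ 2 * P + + 2 * M * N * P + + 12 * M ^ 2 * N * P
      - + 4 * M ^ 3 * N ^ 2 * P + + 4 * M ^ 3 * N ^ 3 * P + + 4 * M * N ^ 2 * P )
      - + 2 * M ^ 2 * N ^ 2 + + 2 * P ^ 2
    where
    M = + m
    N = + n
    P = + p

{-# OPTIONS --safe #-}

-- Let π and ρ = 1 − π be the indicators of the big class and of the rest, and α_A those of the small
-- classes.  Summed over the cyclically ordered quadruples, 4ν is invariant under rotation, so each
-- crossing type may be counted from whichever of its endpoints c is convenient.  Cutting the circle
-- at c, the alternating patterns α_A α_B α_A and α_B α_A α_B are together counted by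
-- Σ_{a ∈ A} j(2i + 1 − j), where i and j are the numbers of elements of A and B passed before a; this
-- is i(i + 1) minus (e − 1)e, where e = j − i = h(a) − h(c) for the difference h of the prefix counts
-- of B and A.  Likewise the patterns with two vertices in the big class and two in the rest are
-- governed by squares of differences of H = F_π − q F_ρ, where p = q m n.  This gives an identity
-- 24ν = 24ν* + (sum of products of consecutive integers and of squares), and all the correction
-- terms vanish when the small classes alternate cyclically with q big vertices after each of their
-- vertices.
module Submission where

open import Defs
open import Data.Nat using (ℕ; zero; suc; _≤_; z≤n; s≤s; _<ᵇ_)
open import Data.Nat.Divisibility using (_∣_; divides)
open import Data.Integer using (ℤ; +_; -[1+_]; -_; _+_; _-_; _*_; _^_)
open import Data.Product using (∃; _×_; _,_; proj₁; proj₂)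
open import Relation.Binary.PropositionalEquality
open import Data.Bool using (Bool; true; false; _∧_; not)
open import Data.Empty using (⊥-elim)
open import Data.Fin using (Fin; zero; suc; toℕ; _≟_; _↑ˡ_; _↑ʳ_; combine; remQuot)
open import Data.Fin.Permutation using (Permutation; _⟨$⟩ʳ_; cast-id)
open import Data.Integer.Tactic.RingSolver using (solve-∀)
open import Data.Sum using (_⊎_; inj₁; inj₂)
open import Data.Sum.Function.Propositional using (_⊎-↔_)
open import Function using (_∘_)
open import Function.Bundles using (_↔_; Inverse; mk↔ₛ′)
open import Function.Properties.Inverse using (↔-refl; ↔-sym; ↔-trans)
open import Relation.Nullary using (¬_; yes; no; does)
open import Relation.Nullary.Decidable using (isYes≗does; ⌊_⌋)
open import Relation.Binary.Definitions using (tri<; tri≈; tri>)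
import Algebra.Properties.Semiring.Sum
import Data.Fin.Properties as Fin
import Data.Integer.Properties as ℤ
import Data.Nat as ℕ
import Data.Nat.Properties as ℕ
import Data.Nat.Tactic.RingSolver as ℕ-Solver

-- Quadruples with a diagonal inside one small class have to be subtracted, so a lower bound for ν
-- needs an upper bound for alternating patterns. By inclusion and exclusion, however, the
-- quadruples A B A B return with a plus sign. They are absorbed by weighting the vertex c at which
-- the circle is cut: 2 in the big class, 1 in a small class other than A, 0 in A. With these
-- weights the patterns A B A and B A B seen from c account for all subtracted and all restored
-- quadruples, up to a constant. The weight 0 also keeps c out of A, which the alternation count
-- requires. For the big class the obstacle is a term linear in the differences of H. It has no sign
-- for a fixed c and disappears only in the sum over c, because its coefficients have equal row and
-- column sums. The factor 24 is 4 for the rotations times 6 for the denominators in sums of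
-- squares.

module Sum = Algebra.Properties.Semiring.Sum ℤ.+-*-semiring

open ≡-Reasoning

-- Sums and indicators

-- Opaque, so that the length and the summand can be inferred from a sum.
opaque
  sum : ∀ {n} → (Fin n → ℤ) → ℤ
  sum = Sum.sum

  sum-[] : (f : Fin 0 → ℤ) → sum f ≡ + 0
  sum-[] f = refl

  sum-∷ : ∀ {n} (f : Fin (suc n) → ℤ) → sum f ≡ f zero + sum (f ∘ suc)
  sum-∷ f = refl

  sum-cong : ∀ {n} {f g : Fin n → ℤ} → (∀ i → f i ≡ g i) → sum f ≡ sum g
  sum-cong = Sum.sum-cong-≗

  sum-+ : ∀ {n} (f g : Fin n → ℤ) → sum (λ i → f i + g i) ≡ sum f + sum g
  sum-+ = Sum.∑-distrib-+

  sum-comm : ∀ {m n} (f : Fin m → Fin n → ℤ) → sum (λ i → sum λ j → f i j) ≡ sum λ j → sum λ i → f i j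
  sum-comm = Sum.∑-comm

  sum-*ˡ : ∀ {n} x (f : Fin n → ℤ) → x * sum f ≡ sum λ i → x * f i
  sum-*ˡ = Sum.*-distribˡ-sum

  sum-*ʳ : ∀ {n} x (f : Fin n → ℤ) → sum f * x ≡ sum λ i → f i * x
  sum-*ʳ = Sum.*-distribʳ-sum

  sum-permute : ∀ {m n} (f : Fin n → ℤ) (π : Permutation m n) → sum f ≡ sum λ i → f (π ⟨$⟩ʳ i)
  sum-permute = Sum.∑-permute

  sum-zero : ∀ n → sum {n} (λ _ → + 0) ≡ + 0
  sum-zero = Sum.sum-replicate-zero

sum-- : ∀ {N} (f g : Fin N → ℤ) → sum (λ i → f i - g i) ≡ sum f - sum g
sum-- f g = trans (sum-cong (λ i → arith (f i) (g i)))
  (trans (sum-+ f (λ i → - (+ 1) * g i)) (trans (cong (λ s → sum f + s) (sym (sum-*ˡ (- (+ 1)) g))) (sym (arith (sum f) (sum g)))))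
  where
  arith : ∀ a b → a - b ≡ a + - (+ 1) * b
  arith = solve-∀

sum-const : ∀ n x → sum {n} (λ _ → x) ≡ + n * x
sum-const zero    x = trans (sum-[] _) (sym (ℤ.*-zeroˡ x))
sum-const (suc n) x = trans (sum-∷ _) (trans (cong (λ s → x + s) (sum-const n x)) (arith x (+ n)))
  where
  arith : ∀ x n → x + n * x ≡ (+ 1 + n) * x
  arith = solve-∀

sum-product : ∀ {M N} (f : Fin M → ℤ) (g : Fin N → ℤ) →
  sum (λ i → sum λ j → f i * g j) ≡ sum f * sum g
sum-product f g = begin
  sum (λ i → sum λ j → f i * g j)  ≡⟨ sum-cong (λ i → sym (sum-*ˡ (f i) g)) ⟩
  sum (λ i → f i * sum g)          ≡⟨ sym (sum-*ʳ (sum g) f) ⟩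
  sum f * sum g                    ∎

sum-telescope : ∀ N (g : ℕ → ℤ) → sum {N} (λ x → g (suc (toℕ x)) - g (toℕ x)) ≡ g N - g 0
sum-telescope zero    g = trans (sum-[] _) (sym (ℤ.+-inverseʳ (g 0)))
sum-telescope (suc N) g = trans (sum-∷ _) (trans (cong (λ s → g 1 - g 0 + s) (sum-telescope N (g ∘ suc))) (arith (g 1) (g 0) (g (suc N))))
  where
  arith : ∀ a b c → a - b + (c - a) ≡ c - b
  arith = solve-∀

⟦_⟧ : Bool → ℤ
⟦ true  ⟧ = + 1
⟦ false ⟧ = + 0

Bit : ℤ → Set
Bit x = x ≡ + 0 ⊎ x ≡ + 1

δ : ∀ {n} → Fin n → Fin n → ℤ
δ i j = ⟦ does (i ≟ j) ⟧

δ-refl : ∀ {n} (i : Fin n) → δ i i ≡ + 1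
δ-refl i with i ≟ i
... | yes _   = refl
... | no  i≢i = ⊥-elim (i≢i refl)

δ-≢ : ∀ {n} {i j : Fin n} → i ≢ j → δ i j ≡ + 0
δ-≢ {i = i} {j} i≢j with i ≟ j
... | yes i≡j = ⊥-elim (i≢j i≡j)
... | no  _   = refl

δ-sym : ∀ {n} (i j : Fin n) → δ i j ≡ δ j i
δ-sym i j with i ≟ j
... | yes refl = sym (δ-refl i)
... | no  i≢j  = sym (δ-≢ (i≢j ∘ sym))

δ-bit : ∀ {k} (i j : Fin k) → Bit (δ i j)
δ-bit i j with i ≟ j
... | yes _ = inj₂ refl
... | no  _ = inj₁ refl

sum-δ : ∀ {n} (i : Fin n) (f : Fin n → ℤ) → sum (λ j → δ i j * f j) ≡ f i
sum-δ {suc n} zero f = begin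
  sum (λ j → δ zero j * f j)                  ≡⟨ sum-∷ _ ⟩
  + 1 * f zero + sum (λ j → + 0 * f (suc j))  ≡⟨ cong₂ _+_ (ℤ.*-identityˡ (f zero)) (sum-cong (λ j → ℤ.*-zeroˡ (f (suc j)))) ⟩
  f zero + sum {n} (λ _ → + 0)                ≡⟨ cong (λ s → f zero + s) (sum-zero n) ⟩
  f zero + + 0                                ≡⟨ ℤ.+-identityʳ _ ⟩
  f zero                                      ∎
sum-δ {suc n} (suc i) f = trans (sum-∷ _) (trans (cong₂ _+_ (ℤ.*-zeroˡ (f zero)) (sum-δ i (f ∘ suc))) (ℤ.+-identityˡ _))

distinct : ∀ {n} → Fin n → Fin n → ℤ
distinct i j = + 1 - δ i j

-- Arcs are complementary only for different endpoints, so every use of `arc-reverse` under a sum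
-- passes through this lemma.
distinct-cong : ∀ {n} (i j : Fin n) {x y} → (i ≢ j → x ≡ y) → distinct i j * x ≡ distinct i j * y
distinct-cong i j {x} {y} h with i ≟ j
... | yes refl = trans (ℤ.*-zeroˡ x) (sym (ℤ.*-zeroˡ y))
... | no  i≢j  = cong (λ s → + 1 * s) (h i≢j)

distinct-sym : ∀ {n} (i j : Fin n) → distinct i j ≡ distinct j i
distinct-sym i j = cong (λ s → + 1 - s) (δ-sym i j)

lt : ℕ → ℕ → ℤ
lt a b = ⟦ a <ᵇ b ⟧

lt-true : ∀ {a b} → a ℕ.< b → lt a b ≡ + 1
lt-true {zero}  (s≤s _)   = refl
lt-true {suc a} (s≤s a<b) = lt-true a<b

lt-false : ∀ {a b} → ¬ a ℕ.< b → lt a b ≡ + 0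
lt-false {a}     {zero}  _   = refl
lt-false {zero}  {suc b} a≮b = ⊥-elim (a≮b (s≤s z≤n))
lt-false {suc a} {suc b} a≮b = lt-false (a≮b ∘ s≤s)

lt-suc : ∀ a b → lt a (suc b) ≡ + 1 - lt b a
lt-suc a b with b ℕ.<? a
... | yes b<a rewrite lt-true b<a | lt-false (ℕ.<⇒≱ b<a ∘ ℕ.≤-pred) = refl
... | no  b≮a rewrite lt-false b≮a | lt-true (s≤s (ℕ.≮⇒≥ b≮a)) = refl

lt-suc-≢ : ∀ {a b} → a ≢ b → lt a (suc b) ≡ lt a b
lt-suc-≢ {a} {b} a≢b with a ℕ.<? b
... | yes a<b = trans (lt-true (ℕ.m<n⇒m<1+n a<b)) (sym (lt-true a<b))
... | no  a≮b = trans (lt-false (λ a<1+b → a≮b (ℕ.≤∧≢⇒< (ℕ.≤-pred a<1+b) a≢b))) (sym (lt-false a≮b))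

lt-swap : ∀ {a b} → a ≢ b → lt b a ≡ + 1 - lt a b
lt-swap {a} {b} a≢b = trans (sym (lt-suc-≢ (a≢b ∘ sym))) (lt-suc b a)

lt-contradictory : ∀ {a c} b → c ℕ.≤ a → lt a b * lt b c ≡ + 0
lt-contradictory {a} {c} b c≤a with a ℕ.<? b
... | no  a≮b rewrite lt-false a≮b = ℤ.*-zeroˡ (lt b c)
... | yes a<b rewrite lt-false {b} {c} (ℕ.<⇒≱ (ℕ.≤-<-trans c≤a a<b) ∘ ℕ.<⇒≤) = ℤ.*-zeroʳ (lt a b)

lt-between : ∀ {a c} b → a ℕ.< c → lt b c + lt a b - + 1 ≡ lt a b * lt b c
lt-between {a} {c} b a<c with a ℕ.<? b
... | yes a<b rewrite lt-true a<b = arith (lt b c)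
  where
  arith : ∀ x → x + + 1 - + 1 ≡ + 1 * x
  arith = solve-∀
... | no  a≮b rewrite lt-false a≮b | lt-true {b} {c} (ℕ.≤-<-trans (ℕ.≮⇒≥ a≮b) a<c) = refl

-- Prefix sums and cyclic arcs

prefix : ∀ {N} → (Fin N → ℤ) → ℕ → ℤ
prefix {zero}  f k       = + 0
prefix {suc N} f zero    = + 0
prefix {suc N} f (suc k) = f zero + prefix (f ∘ suc) k

prefix-0 : ∀ {N} (f : Fin N → ℤ) → prefix f 0 ≡ + 0
prefix-0 {zero}  f = refl
prefix-0 {suc N} f = refl

prefix-suc : ∀ {N} (f : Fin N → ℤ) x → prefix f (suc (toℕ x)) ≡ prefix f (toℕ x) + f x
prefix-suc {suc N} f zero = trans (cong (λ s → f zero + s) (prefix-0 (f ∘ suc))) (ℤ.+-comm (f zero) (+ 0))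
prefix-suc {suc N} f (suc x) = trans (cong (λ s → f zero + s) (prefix-suc (f ∘ suc) x)) (sym (ℤ.+-assoc (f zero) _ _))

prefix-all : ∀ {N} (f : Fin N → ℤ) → prefix f N ≡ sum f
prefix-all {zero}  f = sym (sum-[] f)
prefix-all {suc N} f = trans (cong (λ s → f zero + s) (prefix-all (f ∘ suc))) (sym (sum-∷ f))

prefix-sum : ∀ {N} (f : Fin N → ℤ) k → prefix f k ≡ sum (λ y → lt (toℕ y) k * f y)
prefix-sum {zero}  f k       = sym (sum-[] _)
prefix-sum {suc N} f zero    = sym (trans (sum-cong (λ y → ℤ.*-zeroˡ (f y))) (sum-zero (suc N)))
prefix-sum {suc N} f (suc k) = trans (cong₂ _+_ (sym (ℤ.*-identityˡ (f zero))) (prefix-sum (f ∘ suc) k)) (sym (sum-∷ _))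

-- arc f c k sums f over the positions strictly after c and before k in cyclic order.
arc : ∀ {N} → (Fin N → ℤ) → ℕ → ℕ → ℤ
arc f c k = prefix f k - prefix f (suc c) + sum f * (+ 1 - lt c k)

-- Linear in the comparisons, so that summing against `f` gives prefix sums. For c < y at least one
-- of x < y and c < x holds, and subtracting 1 leaves their conjunction. For y ≤ c they exclude each
-- other and describe the arc that wraps around.
between : ℕ → ℕ → ℕ → ℤ
between c x y = lt x y + lt c x - lt c y

arc-between : ∀ {N} (f : Fin N → ℤ) c y → sum (λ x → between c (toℕ x) y * f x) ≡ arc f c y
arc-between f c y = begin
  sum (λ x → between c (toℕ x) y * f x)
    ≡⟨ sum-cong (λ x → trans (cong (λ l → (lt (toℕ x) y + l - lt c y) * f x) (lt-suc-inv x)) (arith₁ (lt (toℕ x) y) (lt (toℕ x) (suc c)) (lt c y) (f x))) ⟩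
  sum (λ x → lt (toℕ x) y * f x - lt (toℕ x) (suc c) * f x + (+ 1 - lt c y) * f x)
    ≡⟨ sum-+ (λ x → lt (toℕ x) y * f x - lt (toℕ x) (suc c) * f x) _ ⟩
  sum (λ x → lt (toℕ x) y * f x - lt (toℕ x) (suc c) * f x) + sum (λ x → (+ 1 - lt c y) * f x)
    ≡⟨ cong₂ _+_ (trans (sum-- (λ x → lt (toℕ x) y * f x) _) (sym (cong₂ _-_ (prefix-sum f y) (prefix-sum f (suc c)))))
                 (trans (sym (sum-*ˡ (+ 1 - lt c y) f)) (ℤ.*-comm (+ 1 - lt c y) (sum f))) ⟩
  arc f c y ∎
  where
  lt-suc-inv : ∀ x → lt c (toℕ x) ≡ + 1 - lt (toℕ x) (suc c)
  lt-suc-inv x = trans (arith₀ (lt c (toℕ x))) (cong (λ s → + 1 - s) (sym (lt-suc (toℕ x) c)))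
    where
    arith₀ : ∀ a → a ≡ + 1 - (+ 1 - a)
    arith₀ = solve-∀
  arith₁ : ∀ a b l f → (a + (+ 1 - b) - l) * f ≡ a * f - b * f + (+ 1 - l) * f
  arith₁ = solve-∀

toℕ-≢ : ∀ {N} {i j : Fin N} → i ≢ j → toℕ i ≢ toℕ j
toℕ-≢ i≢j = i≢j ∘ Fin.toℕ-injective

arc-reverse : ∀ {N} (f : Fin N → ℤ) {c y} → c ≢ y →
  arc f (toℕ y) (toℕ c) ≡ sum f - f c - f y - arc f (toℕ c) (toℕ y)
arc-reverse f {c} {y} c≢y
  rewrite prefix-suc f c | prefix-suc f y | lt-swap (toℕ-≢ c≢y)
  = arith (prefix f (toℕ c)) (prefix f (toℕ y)) (f c) (f y) (sum f) (lt (toℕ c) (toℕ y))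
  where
  arith : ∀ pc py c y s l → pc - (py + y) + s * (+ 1 - (+ 1 - l)) ≡ s - c - y - (py - (pc + c) + s * (+ 1 - l))
  arith = solve-∀

-- Going once around the circle from c: both arcs start at 0 and end at the full count without c.
cyclic-telescope : ∀ {N} (f g : Fin N → ℤ) (Φ : ℤ → ℤ → ℤ) c →
  sum (λ y → distinct c y * (Φ (arc f (toℕ c) (toℕ y) + f y) (arc g (toℕ c) (toℕ y) + g y)
                             - Φ (arc f (toℕ c) (toℕ y)) (arc g (toℕ c) (toℕ y))))
  ≡ Φ (sum f - f c) (sum g - g c) - Φ (+ 0) (+ 0)
cyclic-telescope {N} f g Φ c = begin
  sum (λ y → distinct c y * step y)
    -- Read linearly from 0 to `N`, both arcs grow by the value at `y`, except at `c`, where they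
    -- fall from the full count to 0. There `jump` makes up for the fall. The linear sum closes up
    -- because the arcs at `N` and at 0 agree.
    ≡⟨ sum-cong pointwise ⟩
  sum (λ y → (γ (suc (toℕ y)) - γ (toℕ y)) + δ c y * jump)
    ≡⟨ sum-+ (λ y → γ (suc (toℕ y)) - γ (toℕ y)) _ ⟩
  sum {N} (λ y → γ (suc (toℕ y)) - γ (toℕ y)) + sum (λ y → δ c y * jump)
    ≡⟨ cong₂ _+_ (sum-telescope N γ) (sum-δ c (λ _ → jump)) ⟩
  γ N - γ 0 + jump
    ≡⟨ cong (λ x → x - γ 0 + jump) (cong₂ Φ (period f) (period g)) ⟩
  γ 0 - γ 0 + jump
    ≡⟨ arith (γ 0) jump ⟩
  jump ∎
  where
  k = toℕ c
  γ : ℕ → ℤ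
  γ t = Φ (arc f k t) (arc g k t)
  step : Fin N → ℤ
  step y = Φ (arc f k (toℕ y) + f y) (arc g k (toℕ y) + g y) - γ (toℕ y)
  jump = Φ (sum f - f c) (sum g - g c) - Φ (+ 0) (+ 0)

  arith : ∀ a b → a - a + b ≡ b
  arith = solve-∀

  period : (h : Fin N → ℤ) → arc h k N ≡ arc h k 0
  period h rewrite prefix-all h | prefix-0 h | lt-true (Fin.toℕ<n c) = arith′ (sum h) (prefix h (suc k))
    where
    arith′ : ∀ s p → s - p + s * (+ 1 - + 1) ≡ + 0 - p + s * (+ 1 - + 0)
    arith′ = solve-∀

  advance : (h : Fin N → ℤ) → ∀ {y} → c ≢ y → arc h k (suc (toℕ y)) ≡ arc h k (toℕ y) + h y
  advance h {y} c≢y rewrite prefix-suc h y | lt-suc-≢ (toℕ-≢ c≢y) =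
    arith′ (prefix h (toℕ y)) (h y) (prefix h (suc k)) (sum h * (+ 1 - lt k (toℕ y)))
    where
    arith′ : ∀ p y q s → p + y - q + s ≡ p - q + s + y
    arith′ = solve-∀

  start : (h : Fin N → ℤ) → arc h k (suc k) ≡ + 0
  start h rewrite lt-true (ℕ.n<1+n k) = arith′ (prefix h (suc k)) (sum h)
    where
    arith′ : ∀ p s → p - p + s * (+ 1 - + 1) ≡ + 0
    arith′ = solve-∀

  end : (h : Fin N → ℤ) → arc h k k ≡ sum h - h c
  end h rewrite prefix-suc h c | lt-false (ℕ.n≮n k) = arith′ (prefix h k) (h c) (sum h)
    where
    arith′ : ∀ p c s → p - (p + c) + s * (+ 1 - + 0) ≡ s - c
    arith′ = solve-∀

  pointwise : ∀ y → distinct c y * step y ≡ (γ (suc (toℕ y)) - γ (toℕ y)) + δ c y * jump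
  pointwise y with c ≟ y
  ... | no c≢y = trans (cong (λ x → + 1 * (x - γ (toℕ y))) (sym (cong₂ Φ (advance f c≢y) (advance g c≢y))))
                       (arith′ (γ (suc (toℕ y)) - γ (toℕ y)) jump)
    where
    arith′ : ∀ a j → + 1 * a ≡ a + + 0 * j
    arith′ = solve-∀
  ... | yes refl = trans (arith′ (step c) (Φ (+ 0) (+ 0)) (Φ (sum f - f c) (sum g - g c)))
                         (cong₂ (λ a b → a - b + + 1 * jump)
                           (sym (cong₂ Φ (start f) (start g)))
                           (sym (cong₂ Φ (end f) (end g))))
    where
    arith′ : ∀ s a b → + 0 * s ≡ a - b + + 1 * (b - a)
    arith′ = solve-∀

-- Sums over cyclically ordered quadruples

chain : ℕ → ℕ → ℕ → ℕ → ℤ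
chain a b c d = lt a b * (lt b c * lt c d)

cyclic : ℕ → ℕ → ℕ → ℕ → ℤ
cyclic a b c d = chain a b c d + chain b c d a + chain c d a b + chain d a b c

cyclic-rotate : ∀ a b c d → cyclic a b c d ≡ cyclic b c d a
cyclic-rotate a b c d = arith (chain a b c d) _ _ _
  where
  arith : ∀ p q r s → p + q + r + s ≡ q + r + s + p
  arith = solve-∀

private
  cyclic-< : ∀ {c y} x z → c ℕ.< y → cyclic c x y z ≡ between c x y * between y z c
  cyclic-< {c} {y} x z c<y = trans
    -- The terms containing both y < z and z < c vanish, since c < y.
    (arith (lt c x) (lt x y) (lt y z) (lt z c) (lt-contradictory z (ℕ.<⇒≤ c<y)))
    (cong₂ _*_ (trans (sym (lt-between x c<y)) (cong (λ l → lt x y + lt c x - l) (sym (lt-true c<y))))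
               (cong (λ l → lt z c + lt y z - l) (sym (lt-false (ℕ.<⇒≱ c<y ∘ ℕ.<⇒≤)))))
    where
    arith : ∀ cx xy yz zc → yz * zc ≡ + 0 →
      cx * (xy * yz) + xy * (yz * zc) + yz * (zc * cx) + zc * (cx * xy) ≡ (cx * xy) * (zc + yz - + 0)
    arith cx xy yz zc e = trans (expand cx xy yz zc) (trans (cong (λ w → (xy + cx) * w + (cx * xy) * (zc + yz - + 0)) e) (collapse (xy + cx) _))
      where
      expand : ∀ cx xy yz zc → cx * (xy * yz) + xy * (yz * zc) + yz * (zc * cx) + zc * (cx * xy)
        ≡ (xy + cx) * (yz * zc) + (cx * xy) * (zc + yz - + 0)
      expand = solve-∀
      collapse : ∀ a b → a * + 0 + b ≡ b
      collapse = solve-∀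

-- The chord from `c` to `y` separates `x` from `z`. The factor `distinct` is necessary: for y = c,
-- `between` holds on the whole circle apart from `c`.
cyclic-between : ∀ {N} (c x y z : Fin N) → cyclic (toℕ c) (toℕ x) (toℕ y) (toℕ z)
  ≡ distinct c y * (between (toℕ c) (toℕ x) (toℕ y) * between (toℕ y) (toℕ z) (toℕ c))
cyclic-between c x y z with c ≟ y
... | yes refl = begin
  cyclic k a k b                         ≡⟨ arith (lt k a) (lt a k) (lt k b) (lt b k) ⟩
  lt k a * lt a k * (lt k b + lt b k) + lt k b * lt b k * (lt a k + lt k a)
    ≡⟨ cong₂ (λ u v → u * (lt k b + lt b k) + v * (lt a k + lt k a)) (lt-contradictory a ℕ.≤-refl) (lt-contradictory b ℕ.≤-refl) ⟩
  + 0 * (lt k b + lt b k) + + 0 * (lt a k + lt k a)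
    ≡⟨ arith′ (lt k b + lt b k) (lt a k + lt k a) (between k a k * between k b k) ⟩
  + 0 * (between k a k * between k b k)  ∎
  where
  k = toℕ c
  a = toℕ x
  b = toℕ z
  arith : ∀ ka ak kb bk → ka * (ak * kb) + ak * (kb * bk) + kb * (bk * ka) + bk * (ka * ak)
    ≡ ka * ak * (kb + bk) + kb * bk * (ak + ka)
  arith = solve-∀
  arith′ : ∀ u v w → + 0 * u + + 0 * v ≡ + 0 * w
  arith′ = solve-∀
... | no c≢y with ℕ.<-cmp (toℕ c) (toℕ y)
...   | tri< c<y _ _ = trans (cyclic-< (toℕ x) (toℕ z) c<y) (sym (ℤ.*-identityˡ _))
...   | tri≈ _ c≡y _ = ⊥-elim (c≢y (Fin.toℕ-injective c≡y))
...   | tri> _ _ y<c = begin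
  cyclic (toℕ c) (toℕ x) (toℕ y) (toℕ z)
    ≡⟨ trans (cyclic-rotate (toℕ c) (toℕ x) (toℕ y) (toℕ z)) (cyclic-rotate (toℕ x) (toℕ y) (toℕ z) (toℕ c)) ⟩
  cyclic (toℕ y) (toℕ z) (toℕ c) (toℕ x)
    ≡⟨ cyclic-< (toℕ z) (toℕ x) y<c ⟩
  between (toℕ y) (toℕ z) (toℕ c) * between (toℕ c) (toℕ x) (toℕ y)
    ≡⟨ trans (ℤ.*-comm (between (toℕ y) (toℕ z) (toℕ c)) _) (sym (ℤ.*-identityˡ _)) ⟩
  + 1 * (between (toℕ c) (toℕ x) (toℕ y) * between (toℕ y) (toℕ z) (toℕ c)) ∎

Weight : ℕ → Set
Weight N = Fin N → Fin N → Fin N → Fin N → ℤ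

∑⁴ : ∀ {N} → Weight N → ℤ
∑⁴ w = sum λ a → sum λ b → sum λ c → sum λ d → w a b c d

∑⁴-cong : ∀ {N} {v w : Weight N} → (∀ a b c d → v a b c d ≡ w a b c d) → ∑⁴ v ≡ ∑⁴ w
∑⁴-cong e = sum-cong λ a → sum-cong λ b → sum-cong λ c → sum-cong λ d → e a b c d

∑⁴-+ : ∀ {N} (v w : Weight N) → ∑⁴ (λ a b c d → v a b c d + w a b c d) ≡ ∑⁴ v + ∑⁴ w
∑⁴-+ v w = trans (sum-cong λ a → trans (sum-cong λ b → trans (sum-cong λ c → sum-+ (v a b c) _)
  (sum-+ (λ c → sum (v a b c)) _)) (sum-+ (λ b → sum λ c → sum (v a b c)) _)) (sum-+ (λ a → sum λ b → sum λ c → sum (v a b c)) _)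

∑⁴-- : ∀ {N} (v w : Weight N) → ∑⁴ (λ a b c d → v a b c d - w a b c d) ≡ ∑⁴ v - ∑⁴ w
∑⁴-- v w = trans (sum-cong λ a → trans (sum-cong λ b → trans (sum-cong λ c → sum-- (v a b c) _)
  (sum-- (λ c → sum (v a b c)) _)) (sum-- (λ b → sum λ c → sum (v a b c)) _)) (sum-- (λ a → sum λ b → sum λ c → sum (v a b c)) _)

∑⁴-sum : ∀ {N n} (w : Fin n → Weight N) →
  ∑⁴ (λ a b c d → sum λ i → w i a b c d) ≡ sum λ i → ∑⁴ (w i)
∑⁴-sum w = trans (sum-cong λ a → trans (sum-cong λ b → trans (sum-cong λ c → sum-comm (λ d i → w i a b c d))
  (sum-comm (λ c i → sum (w i a b c)))) (sum-comm (λ b i → sum λ c → sum (w i a b c)))) (sum-comm (λ a i → sum λ b → sum λ c → sum (w i a b c)))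

∑⁴-rotate : ∀ {N} (w : Weight N) → ∑⁴ (λ a b c d → w b c d a) ≡ ∑⁴ w
∑⁴-rotate w = begin
  (sum λ a → sum λ b → sum λ c → sum λ d → w b c d a)  ≡⟨ sum-comm _ ⟩
  (sum λ b → sum λ a → sum λ c → sum λ d → w b c d a)  ≡⟨ sum-cong (λ b → sum-comm _) ⟩
  (sum λ b → sum λ c → sum λ a → sum λ d → w b c d a)  ≡⟨ sum-cong (λ b → sum-cong λ c → sum-comm _) ⟩
  (sum λ b → sum λ c → sum λ d → sum λ a → w b c d a)  ∎

module _ {N : ℕ} where
  linearly : Weight N → Weight N
  linearly w a b c d = chain (toℕ a) (toℕ b) (toℕ c) (toℕ d) * w a b c d

  cyclically : Weight N → Weight N
  cyclically w a b c d = cyclic (toℕ a) (toℕ b) (toℕ c) (toℕ d) * w a b c d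

  G : Weight N → ℤ
  G w = ∑⁴ (cyclically w)

  G-cong : ∀ {v w : Weight N} → (∀ a b c d → v a b c d ≡ w a b c d) → G v ≡ G w
  G-cong e = ∑⁴-cong λ a b c d → cong (cyclic (toℕ a) (toℕ b) (toℕ c) (toℕ d) *_) (e a b c d)

  G-+ : ∀ (v w : Weight N) → G (λ a b c d → v a b c d + w a b c d) ≡ G v + G w
  G-+ v w = trans (∑⁴-cong λ a b c d → ℤ.*-distribˡ-+ (cyclic (toℕ a) (toℕ b) (toℕ c) (toℕ d)) (v a b c d) (w a b c d))
                  (∑⁴-+ (cyclically v) (cyclically w))

  G-- : ∀ (v w : Weight N) → G (λ a b c d → v a b c d - w a b c d) ≡ G v - G w
  G-- v w = trans (∑⁴-cong λ a b c d → arith (cyclic (toℕ a) (toℕ b) (toℕ c) (toℕ d)) (v a b c d) (w a b c d))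
                  (∑⁴-- (cyclically v) (cyclically w))
    where
    arith : ∀ x y z → x * (y - z) ≡ x * y - x * z
    arith = solve-∀

  G-sum : ∀ {n} (w : Fin n → Weight N) → G (λ a b c d → sum λ i → w i a b c d) ≡ sum λ i → G (w i)
  G-sum w = trans (∑⁴-cong λ a b c d → sum-*ˡ (cyclic (toℕ a) (toℕ b) (toℕ c) (toℕ d)) (λ i → w i a b c d))
                  (∑⁴-sum (λ i → cyclically (w i)))

  G-rotate : ∀ (w : Weight N) → G (λ a b c d → w b c d a) ≡ G w
  G-rotate w = trans (∑⁴-cong λ a b c d → cong (_* w b c d a) (cyclic-rotate (toℕ a) (toℕ b) (toℕ c) (toℕ d)))
                     (∑⁴-rotate (cyclically w))

  orbit : Weight N → Weight N
  orbit w a b c d = w a b c d + w b c d a + w c d a b + w d a b c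

  ∑⁴-orbit : ∀ w → ∑⁴ (orbit w) ≡ + 4 * ∑⁴ w
  ∑⁴-orbit w = begin
    ∑⁴ (orbit w)
      ≡⟨ trans (∑⁴-+ (λ a b c d → w a b c d + w b c d a + w c d a b) w₃)
           (cong (_+ ∑⁴ w₃) (trans (∑⁴-+ (λ a b c d → w a b c d + w b c d a) w₂) (cong (_+ ∑⁴ w₂) (∑⁴-+ w w₁)))) ⟩
    ∑⁴ w + ∑⁴ w₁ + ∑⁴ w₂ + ∑⁴ w₃
      ≡⟨ cong₂ _+_ (cong₂ _+_ (cong (λ s → ∑⁴ w + s) r₁) r₂) r₃ ⟩
    ∑⁴ w + ∑⁴ w + ∑⁴ w + ∑⁴ w
      ≡⟨ arith (∑⁴ w) ⟩
    + 4 * ∑⁴ w ∎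
    where
    w₁ w₂ w₃ : Weight N
    w₁ a b c d = w b c d a
    w₂ a b c d = w c d a b
    w₃ a b c d = w d a b c
    r₁ : ∑⁴ w₁ ≡ ∑⁴ w
    r₁ = ∑⁴-rotate w
    r₂ : ∑⁴ w₂ ≡ ∑⁴ w
    r₂ = trans (∑⁴-rotate w₁) r₁
    r₃ : ∑⁴ w₃ ≡ ∑⁴ w
    r₃ = trans (∑⁴-rotate w₂) r₂
    arith : ∀ x → x + x + x + x ≡ + 4 * x
    arith = solve-∀

  G-orbit : ∀ w → G (orbit w) ≡ + 4 * G w
  G-orbit w = trans (∑⁴-cong λ a b c d → trans
      (arith (cyclic′ a b c d) (w a b c d) (w b c d a) (w c d a b) (w d a b c))
      (cong₂ _+_ (cong₂ _+_ (cong (λ s → cyclically w a b c d + s)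
        (cong (_* w b c d a) (rotate a b c d)))
        (cong (_* w c d a b) (trans (rotate a b c d) (rotate b c d a))))
        (cong (_* w d a b c) (sym (rotate d a b c)))))
    (∑⁴-orbit (cyclically w))
    where
    cyclic′ : Weight N
    cyclic′ a b c d = cyclic (toℕ a) (toℕ b) (toℕ c) (toℕ d)
    rotate : ∀ a b c d → cyclic′ a b c d ≡ cyclic′ b c d a
    rotate a b c d = cyclic-rotate (toℕ a) (toℕ b) (toℕ c) (toℕ d)
    arith : ∀ p w x y z → p * (w + x + y + z) ≡ p * w + p * x + p * y + p * z
    arith = solve-∀

  -- `cyclic` is the sum of the four rotations of `chain`, and for an invariant weight each of them
  -- can be renamed into the linear sum. This is the 4 in 4ν.
  G-linear : ∀ (w : Weight N) → (∀ a b c d → w a b c d ≡ w b c d a) → G w ≡ + 4 * ∑⁴ (linearly w)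
  G-linear w inv = trans (∑⁴-cong λ a b c d → trans
      (arith (chain′ a b c d) (chain′ b c d a) (chain′ c d a b) (chain′ d a b c) (w a b c d))
      (cong₂ _+_ (cong₂ _+_ (cong (λ s → linearly w a b c d + s)
        (cong (chain′ b c d a *_) (inv a b c d)))
        (cong (chain′ c d a b *_) (trans (inv a b c d) (inv b c d a))))
        (cong (chain′ d a b c *_) (sym (inv d a b c)))))
    (∑⁴-orbit (linearly w))
    where
    chain′ : Weight N
    chain′ a b c d = chain (toℕ a) (toℕ b) (toℕ c) (toℕ d)
    arith : ∀ p q r s w → (p + q + r + s) * w ≡ p * w + q * w + r * w + s * w
    arith = solve-∀

  -- Quadruples carry a marked first vertex: for indicators, four positions count once for every
  -- rotation that fits the pattern, hence four times in `P f f f f`.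
  P : (f g k l : Fin N → ℤ) → ℤ
  P f g k l = G (λ a b c d → f a * (g b * (k c * l d)))

  P-rotate : ∀ f g k l → P f g k l ≡ P g k l f
  P-rotate f g k l = trans
    (G-cong λ a b c d → arith (f a) (g b) (k c) (l d))
    (G-rotate (λ a b c d → g a * (k b * (l c * f d))))
    where
    arith : ∀ a b c d → a * (b * (c * d)) ≡ b * (c * (d * a))
    arith = solve-∀

  -- The pairs (x , z) separated by the chord from c to y.
  K : Fin N → (g k l : Fin N → ℤ) → ℤ
  K c g k l = sum λ y → distinct c y * (k y * (arc g (toℕ c) (toℕ y) * arc l (toℕ y) (toℕ c)))

  -- Once `c` and `y` are fixed, `x` and `z` range independently over the two arcs, so the double
  -- sum factors.
  P-chord : ∀ f g k l → P f g k l ≡ sum λ c → f c * K c g k l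
  P-chord f g k l = sum-cong λ c → begin
    (sum λ x → sum λ y → sum λ z → cyclic (toℕ c) (toℕ x) (toℕ y) (toℕ z) * (f c * (g x * (k y * l z))))
      ≡⟨ sum-comm _ ⟩
    (sum λ y → sum λ x → sum λ z → cyclic (toℕ c) (toℕ x) (toℕ y) (toℕ z) * (f c * (g x * (k y * l z))))
      ≡⟨ sum-cong (λ y → begin
        (sum λ x → sum λ z → cyclic (toℕ c) (toℕ x) (toℕ y) (toℕ z) * (f c * (g x * (k y * l z))))
          ≡⟨ sum-cong (λ x → sum-cong λ z → trans
               (cong (_* (f c * (g x * (k y * l z)))) (cyclic-between c x y z))
               (arith (distinct c y) (between (toℕ c) (toℕ x) (toℕ y)) (between (toℕ y) (toℕ z) (toℕ c)) (f c) (g x) (k y) (l z))) ⟩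
        (sum λ x → sum λ z → (f c * (distinct c y * k y) * (between (toℕ c) (toℕ x) (toℕ y) * g x)) * (between (toℕ y) (toℕ z) (toℕ c) * l z))
          ≡⟨ sum-product (λ x → f c * (distinct c y * k y) * (between (toℕ c) (toℕ x) (toℕ y) * g x)) _ ⟩
        sum (λ x → f c * (distinct c y * k y) * (between (toℕ c) (toℕ x) (toℕ y) * g x)) * sum (λ z → between (toℕ y) (toℕ z) (toℕ c) * l z)
          ≡⟨ cong₂ _*_ (trans (sym (sum-*ˡ (f c * (distinct c y * k y)) (λ x → between (toℕ c) (toℕ x) (toℕ y) * g x))) (cong (f c * (distinct c y * k y) *_) (arc-between g (toℕ c) (toℕ y))))
                       (arc-between l (toℕ y) (toℕ c)) ⟩
        f c * (distinct c y * k y) * arc g (toℕ c) (toℕ y) * arc l (toℕ y) (toℕ c)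
          ≡⟨ arith′ (f c) (distinct c y) (k y) (arc g (toℕ c) (toℕ y)) (arc l (toℕ y) (toℕ c)) ⟩
        f c * (distinct c y * (k y * (arc g (toℕ c) (toℕ y) * arc l (toℕ y) (toℕ c)))) ∎) ⟩
    (sum λ y → f c * (distinct c y * (k y * (arc g (toℕ c) (toℕ y) * arc l (toℕ y) (toℕ c)))))
      ≡⟨ sym (sum-*ˡ (f c) _) ⟩
    f c * K c g k l ∎
    where
    arith : ∀ n b b′ f g k l → n * (b * b′) * (f * (g * (k * l))) ≡ f * (n * k) * (b * g) * (b′ * l)
    arith = solve-∀
    arith′ : ∀ f n k g l → f * (n * k) * g * l ≡ f * (n * (k * (g * l)))
    arith′ = solve-∀

-- Counting around the circle from a fixed position

-- Indexed by the values themselves: matching substitutes numbers and leaves polynomial identities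
-- that need not hold for other pairs.
data Exclusive : ℤ → ℤ → Set where
  neither : Exclusive (+ 0) (+ 0)
  left    : Exclusive (+ 1) (+ 0)
  right   : Exclusive (+ 0) (+ 1)

exclusive-bit : ∀ {x y} → Exclusive x y → Bit x
exclusive-bit neither = inj₁ refl
exclusive-bit left    = inj₂ refl
exclusive-bit right   = inj₁ refl

module _ {N : ℕ} where

  -- Successive elements y of f have arcs 0, 1, 2, … from c.
  arc-sum : ∀ (f : Fin N → ℤ) → (∀ y → Bit (f y)) → (φ Φ : ℤ → ℤ) → (∀ i → Φ (i + + 1) - Φ i ≡ φ i) →
    ∀ c → sum (λ y → distinct c y * (f y * φ (arc f (toℕ c) (toℕ y)))) ≡ Φ (sum f - f c) - Φ (+ 0)
  arc-sum f bit φ Φ step c = trans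
    (sum-cong λ y → cong (distinct c y *_) (pointwise (arc f (toℕ c) (toℕ y)) (bit y)))
    (cyclic-telescope f f (λ i _ → Φ i) c)
    where
    pointwise : ∀ i {b} → Bit b → b * φ i ≡ Φ (i + b) - Φ i
    pointwise i (inj₁ refl) = trans (ℤ.*-zeroˡ (φ i)) (trans (sym (ℤ.+-inverseʳ (Φ i))) (cong (λ j → Φ j - Φ i) (sym (ℤ.+-identityʳ i))))
    pointwise i (inj₂ refl) = trans (ℤ.*-identityˡ (φ i)) (sym (step i))

  -- With t elements other than `c`, a middle element preceded by i of them is followed by t - 1 -
  -- i. Summing i (t - 1 - i) counts the triples.
  K-self : ∀ (f : Fin N → ℤ) → (∀ y → Bit (f y)) → ∀ c →
    + 6 * K c f f f ≡ (sum f - f c) * (sum f - f c - + 1) * (sum f - f c - + 2)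
  K-self f bit c = begin
    + 6 * K c f f f
      ≡⟨ sum-*ˡ (+ 6) _ ⟩
    (sum λ y → + 6 * (distinct c y * (f y * (arc f (toℕ c) (toℕ y) * arc f (toℕ y) (toℕ c)))))
      ≡⟨ sum-cong (λ y → trans (arith₁ (distinct c y) (f y) _) (distinct-cong c y λ c≢y →
           trans (cong (λ s → + 6 * (f y * (arc f (toℕ c) (toℕ y) * s))) (arc-reverse f c≢y))
                 (pointwise (arc f (toℕ c) (toℕ y)) (bit y)))) ⟩
    (sum λ y → distinct c y * (f y * φ (arc f (toℕ c) (toℕ y))))
      ≡⟨ arc-sum f bit φ Φ arith₂ c ⟩
    Φ t - Φ (+ 0)
      ≡⟨ arith₃ t ⟩
    t * (t - + 1) * (t - + 2) ∎
    where
    t = sum f - f c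
    φ Φ : ℤ → ℤ
    φ i = + 6 * (i * (t - + 1 - i))
    -- Antidifference of 6 i (t - 1 - i): the first term comes from the sum of i, the second from
    -- the sum of squares.
    Φ i = + 3 * (t - + 1) * (i * (i - + 1)) - (i - + 1) * i * (+ 2 * i - + 1)
    arith₁ : ∀ d f x → + 6 * (d * (f * x)) ≡ d * (+ 6 * (f * x))
    arith₁ = solve-∀
    pointwise : ∀ i {b} → Bit b → + 6 * (b * (i * (t - b - i))) ≡ b * φ i
    pointwise i (inj₁ refl) = refl
    pointwise i (inj₂ refl) = arith t i
      where
      arith : ∀ t i → + 6 * (+ 1 * (i * (t - + 1 - i))) ≡ + 1 * (+ 6 * (i * (t - + 1 - i)))
      arith = solve-∀
    arith₂ : ∀ i → Φ (i + + 1) - Φ i ≡ φ i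
    arith₂ = go t
      where
      go : ∀ t i → + 3 * (t - + 1) * ((i + + 1) * (i + + 1 - + 1)) - (i + + 1 - + 1) * (i + + 1) * (+ 2 * (i + + 1) - + 1)
         - (+ 3 * (t - + 1) * (i * (i - + 1)) - (i - + 1) * i * (+ 2 * i - + 1)) ≡ + 6 * (i * (t - + 1 - i))
      go = solve-∀
    arith₃ : ∀ t → + 3 * (t - + 1) * (t * (t - + 1)) - (t - + 1) * t * (+ 2 * t - + 1)
      - (+ 3 * (t - + 1) * (+ 0 * (+ 0 - + 1)) - (+ 0 - + 1) * + 0 * (+ 2 * + 0 - + 1)) ≡ t * (t - + 1) * (t - + 2)
    arith₃ = solve-∀

  P-self : ∀ (g f : Fin N → ℤ) → (∀ y → Bit (f y)) →
    + 6 * P g f f f ≡ sum λ c → g c * ((sum f - f c) * (sum f - f c - + 1) * (sum f - f c - + 2))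
  P-self g f bit = trans (cong (+ 6 *_) (P-chord g f f f)) (trans (sum-*ˡ (+ 6) _)
    (sum-cong λ c → trans (arith (g c) (K c f f f)) (cong (g c *_) (K-self f bit c))))
    where
    arith : ∀ g k → + 6 * (g * k) ≡ g * (+ 6 * k)
    arith = solve-∀

  -- Alternation of two small classes

  excess : (α β : Fin N → ℤ) → Fin N → ℤ
  excess α β x = prefix β (toℕ x) - prefix α (toℕ x)

  -- How far, seen from c, the elements of α and β are from alternating.
  defect : (α β : Fin N → ℤ) → Fin N → ℤ
  defect α β c = sum λ y → distinct c y *
    (α y * ((excess α β y - excess α β c - + 1) * (excess α β y - excess α β c - β c)))

  -- Along the word read from c, with i elements of α and j of β passed, the weighted count
  -- of the patterns αβα and βαβ telescopes up to the defect.
  K-alternating : ∀ (α β : Fin N → ℤ) m → (∀ y → Exclusive (α y) (β y)) → sum α ≡ m → sum β ≡ m →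
    ∀ c → α c ≡ + 0 →
    + 6 * (K c α β α + K c β α β)
      ≡ + 2 * ((m - + 1) * m * (m + + 1)) - + 3 * (β c * (m * (m - + 1))) - + 6 * defect α β c
  K-alternating α β m excl refl Σβ≡m c αc≡0 = move _ _ _ (begin
    + 6 * (K c α β α + K c β α β) + + 6 * defect α β c
      ≡⟨ cong (λ s → + 6 * s + + 6 * defect α β c) (sym (sum-+ x₁ x₂)) ⟩
    + 6 * sum (λ y → x₁ y + x₂ y) + + 6 * defect α β c
      ≡⟨ trans (sym (ℤ.*-distribˡ-+ (+ 6) (sum (λ y → x₁ y + x₂ y)) (defect α β c)))
           (trans (cong (+ 6 *_) (sym (sum-+ (λ y → x₁ y + x₂ y) x₃))) (sum-*ˡ (+ 6) (λ y → x₁ y + x₂ y + x₃ y))) ⟩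
    sum (λ y → + 6 * (x₁ y + x₂ y + x₃ y))
      ≡⟨ sum-cong pointwise ⟩
    sum (λ y → distinct c y * (Φ (arc α (toℕ c) (toℕ y) + α y) (arc β (toℕ c) (toℕ y) + β y)
                              - Φ (arc α (toℕ c) (toℕ y)) (arc β (toℕ c) (toℕ y))))
      ≡⟨ cyclic-telescope α β Φ c ⟩
    Φ (m - α c) (sum β - β c) - Φ (+ 0) (+ 0)
      ≡⟨ cong₂ (λ a b → Φ (m - a) (b - β c) - Φ (+ 0) (+ 0)) αc≡0 Σβ≡m ⟩
    Φ (m - + 0) (m - β c) - Φ (+ 0) (+ 0)
      ≡⟨ arith-end m (β c) ⟩
    + 2 * ((m - + 1) * m * (m + + 1)) - + 3 * (β c * (m * (m - + 1))) ∎)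
    where
    x₁ x₂ x₃ : Fin N → ℤ
    x₁ y = distinct c y * (β y * (arc α (toℕ c) (toℕ y) * arc α (toℕ y) (toℕ c)))
    x₂ y = distinct c y * (α y * (arc β (toℕ c) (toℕ y) * arc β (toℕ y) (toℕ c)))
    x₃ y = distinct c y * (α y * ((excess α β y - excess α β c - + 1) * (excess α β y - excess α β c - β c)))

    -- The first term is a summation by parts: it moves the sum of i (m - i) over `β` to the
    -- elements of `α`, leaving j (2 i + 1 - β c - j) there. Adding the defect turns this into i (i
    -- + 1) - β c i, and the remaining terms are six times its antidifference.
    Φ : ℤ → ℤ → ℤ
    Φ i j = + 6 * (j * (i * (m - i))) + (+ 2 * ((i - + 1) * i * (i + + 1)) - + 3 * (β c * (i * (i - + 1))))

    move : ∀ a b d → a + d ≡ b → a ≡ b - d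
    move a b d refl = arith a d
      where
      arith : ∀ a d → a ≡ a + d - d
      arith = solve-∀

    arith-end : ∀ m b → + 6 * ((m - b) * ((m - + 0) * (m - (m - + 0)))) + (+ 2 * ((m - + 0 - + 1) * (m - + 0) * (m - + 0 + + 1)) - + 3 * (b * ((m - + 0) * (m - + 0 - + 1))))
      - (+ 6 * (+ 0 * (+ 0 * (m - + 0))) + (+ 2 * ((+ 0 - + 1) * + 0 * (+ 0 + + 1)) - + 3 * (b * (+ 0 * (+ 0 - + 1)))))
      ≡ + 2 * ((m - + 1) * m * (m + + 1)) - + 3 * (b * (m * (m - + 1)))
    arith-end = solve-∀

    arith-6 : ∀ d x y z → + 6 * (d * x + d * y + d * z) ≡ d * (+ 6 * (x + y + z))
    arith-6 = solve-∀

    -- The classes are equally large, so the wraparound terms cancel and prefix differences may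
    -- replace arcs. The summand `β c` appears because the arcs leave out `c` itself.
    excess-arc : ∀ y → excess α β y - excess α β c ≡ arc β (toℕ c) (toℕ y) - arc α (toℕ c) (toℕ y) + β c
    excess-arc y rewrite prefix-suc α c | prefix-suc β c | αc≡0 | Σβ≡m =
      arith (prefix β (toℕ y)) (prefix α (toℕ y)) (prefix β (toℕ c)) (prefix α (toℕ c)) (β c) (m * (+ 1 - lt (toℕ c) (toℕ y)))
      where
      arith : ∀ by ay bc ac b s → by - ay - (bc - ac) ≡ by - (bc + b) + s - (ay - (ac + + 0) + s) + b
      arith = solve-∀

    local : ∀ i j b {x y} → Exclusive x y →
      + 6 * (y * (i * (m - + 0 - x - i)) + x * (j * (m - b - y - j)) + x * ((j - i + b - + 1) * (j - i + b - b)))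
      ≡ (+ 6 * ((j + y) * ((i + x) * (m - (i + x)))) + (+ 2 * ((i + x - + 1) * (i + x) * (i + x + + 1)) - + 3 * (b * ((i + x) * (i + x - + 1)))))
        - (+ 6 * (j * (i * (m - i))) + (+ 2 * ((i - + 1) * i * (i + + 1)) - + 3 * (b * (i * (i - + 1)))))
    local i j b neither = arith m i j b
      where
      arith : ∀ m i j b → + 6 * (+ 0 * (i * (m - + 0 - + 0 - i)) + + 0 * (j * (m - b - + 0 - j)) + + 0 * ((j - i + b - + 1) * (j - i + b - b)))
        ≡ (+ 6 * ((j + + 0) * ((i + + 0) * (m - (i + + 0)))) + (+ 2 * ((i + + 0 - + 1) * (i + + 0) * (i + + 0 + + 1)) - + 3 * (b * ((i + + 0) * (i + + 0 - + 1)))))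
          - (+ 6 * (j * (i * (m - i))) + (+ 2 * ((i - + 1) * i * (i + + 1)) - + 3 * (b * (i * (i - + 1)))))
      arith = solve-∀
    local i j b left = arith m i j b
      where
      arith : ∀ m i j b → + 6 * (+ 0 * (i * (m - + 0 - + 1 - i)) + + 1 * (j * (m - b - + 0 - j)) + + 1 * ((j - i + b - + 1) * (j - i + b - b)))
        ≡ (+ 6 * ((j + + 0) * ((i + + 1) * (m - (i + + 1)))) + (+ 2 * ((i + + 1 - + 1) * (i + + 1) * (i + + 1 + + 1)) - + 3 * (b * ((i + + 1) * (i + + 1 - + 1)))))
          - (+ 6 * (j * (i * (m - i))) + (+ 2 * ((i - + 1) * i * (i + + 1)) - + 3 * (b * (i * (i - + 1)))))
      arith = solve-∀
    local i j b right = arith m i j b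
      where
      arith : ∀ m i j b → + 6 * (+ 1 * (i * (m - + 0 - + 0 - i)) + + 0 * (j * (m - b - + 1 - j)) + + 0 * ((j - i + b - + 1) * (j - i + b - b)))
        ≡ (+ 6 * ((j + + 1) * ((i + + 0) * (m - (i + + 0)))) + (+ 2 * ((i + + 0 - + 1) * (i + + 0) * (i + + 0 + + 1)) - + 3 * (b * ((i + + 0) * (i + + 0 - + 1)))))
          - (+ 6 * (j * (i * (m - i))) + (+ 2 * ((i - + 1) * i * (i + + 1)) - + 3 * (b * (i * (i - + 1)))))
      arith = solve-∀

    pointwise : ∀ y → + 6 * (x₁ y + x₂ y + x₃ y) ≡ distinct c y *
      (Φ (arc α (toℕ c) (toℕ y) + α y) (arc β (toℕ c) (toℕ y) + β y) - Φ (arc α (toℕ c) (toℕ y)) (arc β (toℕ c) (toℕ y)))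
    pointwise y = trans (arith-6 (distinct c y) _ _ _) (distinct-cong c y λ c≢y → trans
      (cong (+ 6 *_) (cong₂ _+_ (cong₂ _+_
        (cong (λ s → β y * (arc α (toℕ c) (toℕ y) * s)) (trans (arc-reverse α c≢y) (cong (λ a → m - a - α y - arc α (toℕ c) (toℕ y)) αc≡0)))
        (cong (λ s → α y * (arc β (toℕ c) (toℕ y) * s)) (trans (arc-reverse β c≢y) (cong (λ a → a - β c - β y - arc β (toℕ c) (toℕ y)) Σβ≡m))))
        (cong (λ e → α y * ((e - + 1) * (e - β c))) (excess-arc y))))
      (local (arc α (toℕ c) (toℕ y)) (arc β (toℕ c) (toℕ y)) (β c) (excl y)))

  -- The same shape as for two different classes, so that the two cases can be merged. The extra 6 m
  -- (m - 1) is 2 (m - 1) m (m + 1) minus 2 m (m - 1) (m - 2). The defect is 0 because the excess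
  -- vanishes identically and `c` lies outside the class.
  K-alternating-self : ∀ (α : Fin N → ℤ) m → (∀ y → Bit (α y)) → sum α ≡ m → ∀ c → α c ≡ + 0 →
    + 6 * (K c α α α + K c α α α)
      ≡ + 2 * ((m - + 1) * m * (m + + 1)) - + 3 * (α c * (m * (m - + 1))) - + 6 * (m * (m - + 1)) - + 6 * defect α α c
  K-alternating-self α m bit refl c αc≡0 = begin
    + 6 * (K c α α α + K c α α α)
      ≡⟨ arith₁ (K c α α α) ⟩
    + 2 * (+ 6 * K c α α α)
      ≡⟨ cong (+ 2 *_) (K-self α bit c) ⟩
    + 2 * ((m - α c) * (m - α c - + 1) * (m - α c - + 2))
      ≡⟨ cong (λ a → + 2 * ((m - a) * (m - a - + 1) * (m - a - + 2))) αc≡0 ⟩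
    + 2 * ((m - + 0) * (m - + 0 - + 1) * (m - + 0 - + 2))
      ≡⟨ arith₂ m ⟩
    + 2 * ((m - + 1) * m * (m + + 1)) - + 3 * (+ 0 * (m * (m - + 1))) - + 6 * (m * (m - + 1)) - + 6 * + 0
      ≡⟨ cong₂ (λ a d → + 2 * ((m - + 1) * m * (m + + 1)) - + 3 * (a * (m * (m - + 1))) - + 6 * (m * (m - + 1)) - + 6 * d)
           (sym αc≡0) (sym (trans (sum-cong vanish) (sum-zero N))) ⟩
    + 2 * ((m - + 1) * m * (m + + 1)) - + 3 * (α c * (m * (m - + 1))) - + 6 * (m * (m - + 1)) - + 6 * defect α α c ∎
    where
    arith₁ : ∀ k → + 6 * (k + k) ≡ + 2 * (+ 6 * k)
    arith₁ = solve-∀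
    arith₂ : ∀ m → + 2 * ((m - + 0) * (m - + 0 - + 1) * (m - + 0 - + 2))
      ≡ + 2 * ((m - + 1) * m * (m + + 1)) - + 3 * (+ 0 * (m * (m - + 1))) - + 6 * (m * (m - + 1)) - + 6 * + 0
    arith₂ = solve-∀
    vanish : ∀ y → distinct c y * (α y * ((excess α α y - excess α α c - + 1) * (excess α α y - excess α α c - α c))) ≡ + 0
    vanish y rewrite αc≡0 = arith (distinct c y) (α y) (prefix α (toℕ y)) (prefix α (toℕ c))
      where
      arith : ∀ d a p q → d * (a * ((p - p - (q - q) - + 1) * (p - p - (q - q) - + 0))) ≡ + 0
      arith = solve-∀

  -- Distribution of the big class among the other vertices

  drift : (ρ π : Fin N → ℤ) → ℤ → Fin N → ℤ
  drift ρ π q x = prefix π (toℕ x) - q * prefix ρ (toℕ x)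

  drift-defect : (ρ π : Fin N → ℤ) → ℤ → Fin N → ℤ
  drift-defect ρ π q c = sum λ y → distinct c y * (ρ y * ((drift ρ π q y - drift ρ π q c) * (drift ρ π q y - drift ρ π q c)))

  module _ (ρ π : Fin N → ℤ) (r q : ℤ) (excl : ∀ y → Exclusive (ρ y) (π y))
           (Σρ≡r : sum ρ ≡ r) (Σπ≡qr : sum π ≡ q * r) where
    private
      bitρ : ∀ y → Bit (ρ y)
      bitρ y = exclusive-bit (excl y)

      H : Fin N → ℤ
      H = drift ρ π q

      ω : Fin N → Fin N → ℤ
      ω c y = + 1 - + 2 * q * (r - + 1 - arc ρ (toℕ c) (toℕ y))

      cross : Fin N → ℤ
      cross c = sum λ y → distinct c y * (ρ y * ((H y - H c) * ω c y))

      -- Six times the sum of q k (q k - 1) over 0 < k < r: the contribution of one `c` when every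
      -- element of `ρ` is followed by q elements of `π`.
      S : ℤ
      S = q * q * ((r - + 1) * r * (+ 2 * r - + 1)) - + 3 * q * (r * (r - + 1))

    -- At an element of `ρ` reached after i others, proportional spacing predicts q (i + 1) passed
    -- elements of `π`; the true number deviates by `H y - H c`. Expanding the quadratic in this
    -- deviation gives the constant `S`, a square, and the linear remainder `cross`.
    K-adjacent : ∀ c → ρ c ≡ + 1 → + 12 * K c ρ π π ≡ S + + 6 * drift-defect ρ π q c + + 6 * cross c
    K-adjacent c ρc≡1 = begin
      + 12 * K c ρ π π
        ≡⟨ arith₀ (K c ρ π π) ⟩
      + 6 * (+ 2 * K c ρ π π)
        ≡⟨ cong (+ 6 *_) by-gaps ⟩
      + 6 * sum (λ y → distinct c y * (ρ y * ((p - j y) * (p - j y - + 1))))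
        ≡⟨ trans (sum-*ˡ (+ 6) _) (sum-cong split) ⟩
      sum (λ y → distinct c y * (ρ y * φ (i y)) + + 6 * (distinct c y * (ρ y * ((H y - H c) * (H y - H c)))) + + 6 * (distinct c y * (ρ y * ((H y - H c) * ω c y))))
        ≡⟨ trans (sum-+ (λ y → distinct c y * (ρ y * φ (i y)) + + 6 * (distinct c y * (ρ y * ((H y - H c) * (H y - H c))))) _)
                 (cong₂ _+_ (trans (sum-+ (λ y → distinct c y * (ρ y * φ (i y))) _)
                   (cong₂ _+_ (trans (arc-sum ρ bitρ φ Ψ arith-step c) Ψ-ends) (sym (sum-*ˡ (+ 6) _)))) (sym (sum-*ˡ (+ 6) _))) ⟩
      S + + 6 * drift-defect ρ π q c + + 6 * cross c ∎
      where
      p = q * r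
      i j : Fin N → ℤ
      i y = arc ρ (toℕ c) (toℕ y)
      j y = arc π (toℕ c) (toℕ y)

      πc≡0 : π c ≡ + 0
      πc≡0 = exclude (excl c) ρc≡1
        where
        exclude : ∀ {x y} → Exclusive x y → x ≡ + 1 → y ≡ + 0
        exclude left _ = refl

      arith₀ : ∀ k → + 12 * k ≡ + 6 * (+ 2 * k)
      arith₀ = solve-∀

      Φ : ℤ → ℤ → ℤ
      Φ i j = - (i * ((p - j) * (p - j - + 1)))

      -- Double counting: rather than the first of the two elements of `π`, the element of `ρ`
      -- before them is fixed, and a pair is chosen from the p - j elements of `π` still to come.
      -- The potential `Φ` performs the exchange and is 0 at both ends of the walk.
      by-gaps : + 2 * K c ρ π π ≡ sum (λ y → distinct c y * (ρ y * ((p - j y) * (p - j y - + 1))))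
      by-gaps = move (begin
        + 2 * K c ρ π π - sum (λ y → distinct c y * (ρ y * ((p - j y) * (p - j y - + 1))))
          ≡⟨ trans (cong (_- gaps) (sum-*ˡ (+ 2) _)) (sym (sum-- _ _)) ⟩
        sum (λ y → + 2 * (distinct c y * (π y * (i y * arc π (toℕ y) (toℕ c)))) - distinct c y * (ρ y * ((p - j y) * (p - j y - + 1))))
          ≡⟨ sum-cong (λ y → trans (factor (distinct c y) _ _) (distinct-cong c y λ c≢y →
               trans (cong (λ a → + 2 * (π y * (i y * a)) - ρ y * ((p - j y) * (p - j y - + 1)))
                       (trans (arc-reverse π c≢y) (cong₂ (λ s a → s - a - π y - j y) Σπ≡qr πc≡0)))
                     (local p (i y) (j y) (excl y)))) ⟩
        sum (λ y → distinct c y * (Φ (i y + ρ y) (j y + π y) - Φ (i y) (j y)))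
          ≡⟨ cyclic-telescope ρ π Φ c ⟩
        Φ (sum ρ - ρ c) (sum π - π c) - Φ (+ 0) (+ 0)
          ≡⟨ cong (λ x → Φ (sum ρ - ρ c) x - Φ (+ 0) (+ 0)) (cong₂ _-_ Σπ≡qr πc≡0) ⟩
        Φ (sum ρ - ρ c) (p - + 0) - Φ (+ 0) (+ 0)
          ≡⟨ ends (sum ρ - ρ c) p ⟩
        + 0 ∎)
        where
        gaps = sum (λ y → distinct c y * (ρ y * ((p - j y) * (p - j y - + 1))))
        move : ∀ {a b} → a - b ≡ + 0 → a ≡ b
        move {a} {b} e = ℤ.i-j≡0⇒i≡j a b e
        factor : ∀ d x y → + 2 * (d * x) - d * y ≡ d * (+ 2 * x - y)
        factor = solve-∀
        ends : ∀ i p → - (i * ((p - (p - + 0)) * (p - (p - + 0) - + 1))) - - (+ 0 * ((p - + 0) * (p - + 0 - + 1))) ≡ + 0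
        ends = solve-∀
        local : ∀ p i j {x y} → Exclusive x y →
          + 2 * (y * (i * (p - + 0 - y - j))) - x * ((p - j) * (p - j - + 1))
          ≡ - ((i + x) * ((p - (j + y)) * (p - (j + y) - + 1))) - - (i * ((p - j) * (p - j - + 1)))
        local p i j neither = arith p i j
          where
          arith : ∀ p i j → + 2 * (+ 0 * (i * (p - + 0 - + 0 - j))) - + 0 * ((p - j) * (p - j - + 1))
            ≡ - ((i + + 0) * ((p - (j + + 0)) * (p - (j + + 0) - + 1))) - - (i * ((p - j) * (p - j - + 1)))
          arith = solve-∀
        local p i j left = arith p i j
          where
          arith : ∀ p i j → + 2 * (+ 0 * (i * (p - + 0 - + 0 - j))) - + 1 * ((p - j) * (p - j - + 1))
            ≡ - ((i + + 1) * ((p - (j + + 0)) * (p - (j + + 0) - + 1))) - - (i * ((p - j) * (p - j - + 1)))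
          arith = solve-∀
        local p i j right = arith p i j
          where
          arith : ∀ p i j → + 2 * (+ 1 * (i * (p - + 0 - + 1 - j))) - + 0 * ((p - j) * (p - j - + 1))
            ≡ - ((i + + 0) * ((p - (j + + 1)) * (p - (j + + 1) - + 1))) - - (i * ((p - j) * (p - j - + 1)))
          arith = solve-∀

      φ Ψ : ℤ → ℤ
      φ i = + 6 * (q * (r - + 1 - i) * (q * (r - + 1 - i) - + 1))
      Ψ i = - (q * q * ((r - i - + 1) * (r - i) * (+ 2 * (r - i) - + 1)) - + 3 * q * ((r - i) * (r - i - + 1)))

      arith-step : ∀ i → Ψ (i + + 1) - Ψ i ≡ φ i
      arith-step = go q r
        where
        go : ∀ q r i → - (q * q * ((r - (i + + 1) - + 1) * (r - (i + + 1)) * (+ 2 * (r - (i + + 1)) - + 1)) - + 3 * q * ((r - (i + + 1)) * (r - (i + + 1) - + 1)))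
          - - (q * q * ((r - i - + 1) * (r - i) * (+ 2 * (r - i) - + 1)) - + 3 * q * ((r - i) * (r - i - + 1)))
          ≡ + 6 * (q * (r - + 1 - i) * (q * (r - + 1 - i) - + 1))
        go = solve-∀

      Ψ-ends : Ψ (sum ρ - ρ c) - Ψ (+ 0) ≡ S
      Ψ-ends = trans (cong (λ x → Ψ x - Ψ (+ 0)) (cong₂ _-_ Σρ≡r ρc≡1)) (arith q r)
        where
        arith : ∀ q r → - (q * q * ((r - (r - + 1) - + 1) * (r - (r - + 1)) * (+ 2 * (r - (r - + 1)) - + 1)) - + 3 * q * ((r - (r - + 1)) * (r - (r - + 1) - + 1)))
          - - (q * q * ((r - + 0 - + 1) * (r - + 0) * (+ 2 * (r - + 0) - + 1)) - + 3 * q * ((r - + 0) * (r - + 0 - + 1)))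
          ≡ q * q * ((r - + 1) * r * (+ 2 * r - + 1)) - + 3 * q * (r * (r - + 1))
        arith = solve-∀

      -- The wraparound terms match because the total of `π` is q times that of `ρ`. The + 1 stands
      -- for `c`, which belongs to `ρ` but not to its own arc.
      gap : ∀ y → j y ≡ q * (i y + + 1) + (H y - H c)
      gap y rewrite prefix-suc ρ c | prefix-suc π c | ρc≡1 | πc≡0 | Σρ≡r | Σπ≡qr =
        arith (prefix π (toℕ y)) (prefix ρ (toℕ y)) (prefix π (toℕ c)) (prefix ρ (toℕ c)) q r (lt (toℕ c) (toℕ y))
        where
        arith : ∀ py ry pc rc q r l → py - (pc + + 0) + q * r * (+ 1 - l)
          ≡ q * (ry - (rc + + 1) + r * (+ 1 - l) + + 1) + (py - q * ry - (pc - q * rc))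
        arith = solve-∀

      split : ∀ y → + 6 * (distinct c y * (ρ y * ((p - j y) * (p - j y - + 1))))
        ≡ distinct c y * (ρ y * φ (i y)) + + 6 * (distinct c y * (ρ y * ((H y - H c) * (H y - H c)))) + + 6 * (distinct c y * (ρ y * ((H y - H c) * ω c y)))
      split y = trans (cong (λ l → + 6 * (distinct c y * (ρ y * ((p - l) * (p - l - + 1))))) (gap y))
        (arith (distinct c y) (ρ y) q r (i y) (H y - H c))
        where
        arith : ∀ d x q r i e → + 6 * (d * (x * ((q * r - (q * (i + + 1) + e)) * (q * r - (q * (i + + 1) + e) - + 1))))
          ≡ d * (x * (+ 6 * (q * (r - + 1 - i) * (q * (r - + 1 - i) - + 1)))) + + 6 * (d * (x * (e * e)))
            + + 6 * (d * (x * (e * (+ 1 - + 2 * q * (r - + 1 - i)))))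
        arith = solve-∀

    private
      θ : ℤ
      θ = (r - + 1) * (+ 1 - q * r)

      row : ∀ c → ρ c ≡ + 1 → sum (λ y → distinct c y * (ρ y * ω c y)) ≡ θ
      row c ρc≡1 = trans
        (arc-sum ρ bitρ (λ i → + 1 - + 2 * q * (r - + 1 - i)) (λ i → i * (+ 1 - + 2 * q * (r - + 1)) + q * (i * (i - + 1))) (step q r) c)
        (trans (cong (λ x → x * (+ 1 - + 2 * q * (r - + 1)) + q * (x * (x - + 1)) - (+ 0 * (+ 1 - + 2 * q * (r - + 1)) + q * (+ 0 * (+ 0 - + 1))))
                 (cong₂ _-_ Σρ≡r ρc≡1)) (arith q r))
        where
        step : ∀ q r i → (i + + 1) * (+ 1 - + 2 * q * (r - + 1)) + q * ((i + + 1) * (i + + 1 - + 1)) - (i * (+ 1 - + 2 * q * (r - + 1)) + q * (i * (i - + 1)))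
          ≡ + 1 - + 2 * q * (r - + 1 - i)
        step = solve-∀
        arith : ∀ q r → (r - + 1) * (+ 1 - + 2 * q * (r - + 1)) + q * ((r - + 1) * (r - + 1 - + 1)) - (+ 0 * (+ 1 - + 2 * q * (r - + 1)) + q * (+ 0 * (+ 0 - + 1)))
          ≡ (r - + 1) * (+ 1 - q * r)
        arith = solve-∀

      -- Now `y` is fixed and `c` varies. Seen from `y` the arc is complementary: r - 1 minus the
      -- arc from `c` to `y` is one more than the arc from `y` to `c`, so the coefficients of a row
      -- recur.
      column : ∀ y → ρ y ≡ + 1 → sum (λ c → distinct c y * (ρ c * ω c y)) ≡ θ
      column y ρy≡1 = begin
        sum (λ c → distinct c y * (ρ c * ω c y))
          ≡⟨ sum-cong (λ c → trans (cong (_* (ρ c * ω c y)) (distinct-sym c y)) (distinct-cong y c λ y≢c → reverse c y≢c (bitρ c) refl)) ⟩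
        sum (λ c → distinct y c * (ρ c * (+ 1 - + 2 * q * (arc ρ (toℕ y) (toℕ c) + + 1))))
          ≡⟨ arc-sum ρ bitρ (λ i → + 1 - + 2 * q * (i + + 1)) (λ i → i - q * (i * (i + + 1))) (step q) y ⟩
        sum ρ - ρ y - q * ((sum ρ - ρ y) * (sum ρ - ρ y + + 1)) - (+ 0 - q * (+ 0 * (+ 0 + + 1)))
          ≡⟨ cong (λ x → x - q * (x * (x + + 1)) - (+ 0 - q * (+ 0 * (+ 0 + + 1)))) (cong₂ _-_ Σρ≡r ρy≡1) ⟩
        r - + 1 - q * ((r - + 1) * (r - + 1 + + 1)) - (+ 0 - q * (+ 0 * (+ 0 + + 1)))
          ≡⟨ arith q r ⟩
        θ ∎
        where
        reverse : ∀ c → y ≢ c → ∀ {b} → Bit b → b ≡ ρ c → b * ω c y ≡ b * (+ 1 - + 2 * q * (arc ρ (toℕ y) (toℕ c) + + 1))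
        reverse c y≢c (inj₁ refl) _ = trans (ℤ.*-zeroˡ (ω c y)) (sym (ℤ.*-zeroˡ (+ 1 - + 2 * q * (arc ρ (toℕ y) (toℕ c) + + 1))))
        reverse c y≢c (inj₂ refl) 1≡ρc = cong (λ a → + 1 * (+ 1 - + 2 * q * a))
          (trans (cong (λ a → r - + 1 - a) (arc-reverse ρ y≢c))
            (trans (cong₂ (λ s t → r - + 1 - (s - t - arc ρ (toℕ y) (toℕ c))) (cong₂ _-_ Σρ≡r ρy≡1) (sym 1≡ρc)) (arith′ r (arc ρ (toℕ y) (toℕ c)))))
          where
          arith′ : ∀ r a → r - + 1 - (r - + 1 - + 1 - a) ≡ a + + 1
          arith′ = solve-∀
        step : ∀ q i → i + + 1 - q * ((i + + 1) * (i + + 1 + + 1)) - (i - q * (i * (i + + 1))) ≡ + 1 - + 2 * q * (i + + 1)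
        step = solve-∀
        arith : ∀ q r → r - + 1 - q * ((r - + 1) * (r - + 1 + + 1)) - (+ 0 - q * (+ 0 * (+ 0 + + 1))) ≡ (r - + 1) * (+ 1 - q * r)
        arith = solve-∀

      on-ρ : ∀ c {x y} → (ρ c ≡ + 1 → x ≡ y) → ρ c * x ≡ ρ c * y
      on-ρ c {x} {y} h with bitρ c
      ... | inj₁ ρc≡0 rewrite ρc≡0 = trans (ℤ.*-zeroˡ x) (sym (ℤ.*-zeroˡ y))
      ... | inj₂ ρc≡1 = cong (ρ c *_) (h ρc≡1)

    -- Rows and columns of `ω`, restricted to distinct elements of `ρ`, all have sum `θ`. Hence each
    -- value of `H` receives the total coefficient `θ` - `θ`.
    cross-cancels : sum (λ c → ρ c * cross c) ≡ + 0
    cross-cancels = begin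
      sum (λ c → ρ c * cross c)
        ≡⟨ sum-cong (λ c → trans (sum-*ˡ (ρ c) _) (trans (sum-cong λ y → arith₁ (ρ c) (distinct c y) (ρ y) (H y) (H c) (ω c y)) (sum-- _ _))) ⟩
      sum (λ c → sum (λ y → ρ y * H y * (distinct c y * (ρ c * ω c y))) - sum (λ y → ρ c * H c * (distinct c y * (ρ y * ω c y))))
        ≡⟨ sum-- _ _ ⟩
      sum (λ c → sum λ y → ρ y * H y * (distinct c y * (ρ c * ω c y))) - sum (λ c → sum λ y → ρ c * H c * (distinct c y * (ρ y * ω c y)))
        ≡⟨ cong₂ _-_ (trans (sum-comm _) (sum-cong λ y → trans (sym (sum-*ˡ (ρ y * H y) _)) (weigh y (column y))))
                     (sum-cong λ c → trans (sym (sum-*ˡ (ρ c * H c) _)) (weigh c (row c))) ⟩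
      sum (λ y → ρ y * (H y * θ)) - sum (λ y → ρ y * (H y * θ))
        ≡⟨ ℤ.+-inverseʳ (sum λ y → ρ y * (H y * θ)) ⟩
      + 0 ∎
      where
      arith₁ : ∀ rc d ry hy hc w → rc * (d * (ry * ((hy - hc) * w))) ≡ ry * hy * (d * (rc * w)) - rc * hc * (d * (ry * w))
      arith₁ = solve-∀
      weigh : ∀ c {x} → (ρ c ≡ + 1 → x ≡ θ) → ρ c * H c * x ≡ ρ c * (H c * θ)
      weigh c {x} h = trans (ℤ.*-assoc (ρ c) (H c) x) (on-ρ c λ e → cong (H c *_) (h e))

    P-adjacent : + 12 * P ρ ρ π π ≡ r * S + + 6 * sum (λ c → ρ c * drift-defect ρ π q c)
    P-adjacent = begin
      + 12 * P ρ ρ π π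
        ≡⟨ trans (cong (+ 12 *_) (P-chord ρ ρ π π)) (sum-*ˡ (+ 12) _) ⟩
      sum (λ c → + 12 * (ρ c * K c ρ π π))
        ≡⟨ sum-cong (λ c → trans (arith₁ (ρ c) (K c ρ π π)) (trans (on-ρ c (K-adjacent c)) (arith₂ (ρ c) S (drift-defect ρ π q c) (cross c)))) ⟩
      sum (λ c → ρ c * S + + 6 * (ρ c * drift-defect ρ π q c) + + 6 * (ρ c * cross c))
        ≡⟨ trans (sum-+ (λ c → ρ c * S + + 6 * (ρ c * drift-defect ρ π q c)) _) (cong₂ _+_
             (trans (sum-+ (λ c → ρ c * S) _) (cong₂ _+_ (trans (sym (sum-*ʳ S ρ)) (cong (_* S) Σρ≡r)) (sym (sum-*ˡ (+ 6) _))))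
             (trans (sym (sum-*ˡ (+ 6) _)) (cong (+ 6 *_) cross-cancels))) ⟩
      r * S + + 6 * sum (λ c → ρ c * drift-defect ρ π q c) + + 6 * + 0
        ≡⟨ ℤ.+-identityʳ _ ⟩
      r * S + + 6 * sum (λ c → ρ c * drift-defect ρ π q c) ∎
      where
      arith₁ : ∀ r k → + 12 * (r * k) ≡ r * (+ 12 * k)
      arith₁ = solve-∀
      arith₂ : ∀ r s d x → r * (s + + 6 * d + + 6 * x) ≡ r * s + + 6 * (r * d) + + 6 * (r * x)
      arith₂ = solve-∀

-- Colour classes of K(p^(1), m^(n))

module _ {p m n : ℕ} where

  big rest : KVertex p m n → ℤ
  big (inj₁ _)  = + 1
  big (inj₂ _)  = + 0
  rest (inj₁ _) = + 0
  rest (inj₂ _) = + 1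

  small : Fin n → KVertex p m n → ℤ
  small A (inj₁ _)       = + 0
  small A (inj₂ (a , _)) = δ a A

  edge : KVertex p m n → KVertex p m n → ℤ
  edge v w = ⟦ adj v w ⟧

  small-bit : ∀ A v → Bit (small A v)
  small-bit A (inj₁ _)       = inj₁ refl
  small-bit A (inj₂ (a , _)) = δ-bit a A

  rest-bit : ∀ v → Bit (rest v)
  rest-bit (inj₁ _) = inj₁ refl
  rest-bit (inj₂ _) = inj₂ refl

  rest-big-exclusive : ∀ v → Exclusive (rest v) (big v)
  rest-big-exclusive (inj₁ _) = right
  rest-big-exclusive (inj₂ _) = left

  small-exclusive : ∀ {A B} → A ≢ B → ∀ v → Exclusive (small A v) (small B v)
  small-exclusive A≢B (inj₁ _) = neither
  small-exclusive {A} {B} A≢B (inj₂ (a , _)) with a ≟ A | a ≟ B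
  ... | yes a≡A | yes a≡B with () ← A≢B (trans (sym a≡A) a≡B)
  ... | yes _   | no  _   = left
  ... | no  _   | yes _   = right
  ... | no  _   | no  _   = neither

  sum-small : ∀ v → sum (λ A → small A v) ≡ rest v
  sum-small (inj₁ _)       = sum-zero n
  sum-small (inj₂ (a , _)) = trans (sum-cong λ A → sym (ℤ.*-identityʳ (δ a A))) (sum-δ a (λ _ → + 1))

  edge-sym : ∀ v w → edge v w ≡ edge w v
  edge-sym (inj₁ _) (inj₁ _) = refl
  edge-sym (inj₁ _) (inj₂ _) = refl
  edge-sym (inj₂ _) (inj₁ _) = refl
  edge-sym (inj₂ (a , _)) (inj₂ (b , _)) with a ≟ b | b ≟ a
  ... | yes _   | yes _   = refl
  ... | no  _   | no  _   = refl
  ... | yes a≡b | no  b≢a with () ← b≢a (sym a≡b)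
  ... | no  a≢b | yes b≡a with () ← a≢b (sym b≡a)

  -- Adjacency as products of class indicators, so that a product of two edges expands into values
  -- of `P`.
  edge-decomposition : ∀ v w → edge v w ≡
    big v * rest w + big w * rest v + (rest v * rest w - sum λ A → small A v * small A w)
  edge-decomposition (inj₁ _) (inj₁ _) = cong (λ s → + 0 + (+ 0 - s)) (sym (sum-zero n))
  edge-decomposition (inj₁ _) (inj₂ (b , _)) = cong (λ s → + 1 + (+ 0 - s))
    (sym (trans (sum-cong λ A → ℤ.*-zeroˡ (δ b A)) (sum-zero n)))
  edge-decomposition (inj₂ (a , _)) (inj₁ _) = cong (λ s → + 1 + (+ 0 - s))
    (sym (trans (sum-cong λ A → ℤ.*-zeroʳ (δ a A)) (sum-zero n)))
  edge-decomposition (inj₂ (a , _)) (inj₂ (b , _)) = trans (adjacent a b)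
    (cong (λ s → + 0 + (+ 1 - s)) (trans (δ-sym a b) (sym (sum-δ a (δ b)))))
    where
    adjacent : ∀ a b → ⟦ not ⌊ a ≟ b ⌋ ⟧ ≡ + 0 + (+ 1 - δ a b)
    adjacent a b with a ≟ b
    ... | yes _ = refl
    ... | no  _ = refl

-- The crossings as a sum over ordered quadruples

∑-sum : ∀ N (f : Fin N → ℕ) → + ∑ N f ≡ sum λ i → + f i
∑-sum zero    f = sym (sum-[] _)
∑-sum (suc N) f = trans (cong (λ s → + f zero + s) (∑-sum N (f ∘ suc))) (sym (sum-∷ _))

⟦⟧-∧ : ∀ a b → ⟦ a ∧ b ⟧ ≡ ⟦ a ⟧ * ⟦ b ⟧
⟦⟧-∧ true  b = sym (ℤ.*-identityˡ ⟦ b ⟧)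
⟦⟧-∧ false b = sym (ℤ.*-zeroˡ ⟦ b ⟧)

+b2n : ∀ b → + b2n b ≡ ⟦ b ⟧
+b2n true  = refl
+b2n false = refl

⟦<⟧ : ∀ {N} (i j : Fin N) → ⟦ ⌊ i Fin.<? j ⌋ ⟧ ≡ lt (toℕ i) (toℕ j)
⟦<⟧ i j = cong ⟦_⟧ (isYes≗does (i Fin.<? j))

crossingsOf-chain : ∀ {N} {V : Set} (e : V → V → Bool) (f : Fin N → V) →
  + crossingsOf e f ≡ ∑⁴ (linearly λ a b c d → ⟦ e (f a) (f c) ⟧ * ⟦ e (f b) (f d) ⟧)
crossingsOf-chain {N} e f = trans (∑-sum N _) (sum-cong λ i → trans (∑-sum N _) (sum-cong λ j →
  trans (∑-sum N _) (sum-cong λ k → trans (∑-sum N _) (sum-cong λ l → pointwise i j k l))))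
  where
  arith : ∀ a b c x y → a * (b * (c * (x * y))) ≡ a * (b * c) * (x * y)
  arith = solve-∀
  pointwise : ∀ i j k l →
    + b2n (⌊ i Fin.<? j ⌋ ∧ ⌊ j Fin.<? k ⌋ ∧ ⌊ k Fin.<? l ⌋ ∧ e (f i) (f k) ∧ e (f j) (f l))
    ≡ chain (toℕ i) (toℕ j) (toℕ k) (toℕ l) * (⟦ e (f i) (f k) ⟧ * ⟦ e (f j) (f l) ⟧)
  pointwise i j k l = begin
    + b2n (i<j ∧ j<k ∧ k<l ∧ x ∧ y)
      ≡⟨ trans (+b2n _) (⟦⟧-∧ i<j _) ⟩
    ⟦ i<j ⟧ * ⟦ j<k ∧ k<l ∧ x ∧ y ⟧
      ≡⟨ cong (⟦ i<j ⟧ *_) (trans (⟦⟧-∧ j<k _) (cong (⟦ j<k ⟧ *_) (trans (⟦⟧-∧ k<l _) (cong (⟦ k<l ⟧ *_) (⟦⟧-∧ x y))))) ⟩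
    ⟦ i<j ⟧ * (⟦ j<k ⟧ * (⟦ k<l ⟧ * (⟦ x ⟧ * ⟦ y ⟧)))
      ≡⟨ arith ⟦ i<j ⟧ ⟦ j<k ⟧ ⟦ k<l ⟧ ⟦ x ⟧ ⟦ y ⟧ ⟩
    ⟦ i<j ⟧ * (⟦ j<k ⟧ * ⟦ k<l ⟧) * (⟦ x ⟧ * ⟦ y ⟧)
      ≡⟨ cong (_* (⟦ x ⟧ * ⟦ y ⟧)) (cong₂ _*_ (⟦<⟧ i j) (cong₂ _*_ (⟦<⟧ j k) (⟦<⟧ k l))) ⟩
    chain (toℕ i) (toℕ j) (toℕ k) (toℕ l) * (⟦ x ⟧ * ⟦ y ⟧) ∎
    where
    i<j = ⌊ i Fin.<? j ⌋
    j<k = ⌊ j Fin.<? k ⌋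
    k<l = ⌊ k Fin.<? l ⌋
    x = e (f i) (f k)
    y = e (f j) (f l)

-- Expansion of 4ν into colour patterns

module _ {N : ℕ} where

  P-cong₁ : ∀ {f f′ : Fin N → ℤ} → (∀ x → f x ≡ f′ x) → ∀ g k l → P f g k l ≡ P f′ g k l
  P-cong₁ e g k l = G-cong λ a b c d → cong (_* (g b * (k c * l d))) (e a)

  P-sum₁ : ∀ {n} (f : Fin n → Fin N → ℤ) g k l → P (λ x → sum λ i → f i x) g k l ≡ sum λ i → P (f i) g k l
  P-sum₁ f g k l = trans (G-cong λ a b c d → sum-*ʳ (g b * (k c * l d)) (λ i → f i a))
    (G-sum λ i a b c d → f i a * (g b * (k c * l d)))

  P-half-turn : ∀ (f g k l : Fin N → ℤ) → P f g k l ≡ P k l f g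
  P-half-turn f g k l = trans (P-rotate f g k l) (P-rotate g k l f)

module Decomposition {N p m n : ℕ} (f : Fin N → KVertex p m n) where

  π ρ : Fin N → ℤ
  π = big ∘ f
  ρ = rest ∘ f

  α : Fin n → Fin N → ℤ
  α A = small A ∘ f

  ∑² : (Fin n → Fin n → ℤ) → ℤ
  ∑² u = sum λ A → sum λ B → u A B

  ∑²-cong : ∀ {u v : Fin n → Fin n → ℤ} → (∀ A B → u A B ≡ v A B) → ∑² u ≡ ∑² v
  ∑²-cong e = sum-cong λ A → sum-cong λ B → e A B

  ∑²-+ : ∀ u v → ∑² (λ A B → u A B + v A B) ≡ ∑² u + ∑² v
  ∑²-+ u v = trans (sum-cong λ A → sum-+ (u A) (v A)) (sum-+ (λ A → sum (u A)) _)

  ∑²-- : ∀ u v → ∑² (λ A B → u A B - v A B) ≡ ∑² u - ∑² v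
  ∑²-- u v = trans (sum-cong λ A → sum-- (u A) (v A)) (sum-- (λ A → sum (u A)) _)

  ∑²-*ˡ : ∀ x u → x * ∑² u ≡ ∑² (λ A B → x * u A B)
  ∑²-*ˡ x u = trans (sum-*ˡ x _) (sum-cong λ A → sum-*ˡ x (u A))

  ∑²-swap : ∀ u → ∑² (λ A B → u B A) ≡ ∑² u
  ∑²-swap u = sum-comm λ A B → u B A

  private
    τ : Fin N → Fin N → ℤ
    τ x y = ρ x * ρ y - sum λ A → α A x * α A y

    τ-sym : ∀ x y → τ x y ≡ τ y x
    τ-sym x y = cong₂ _-_ (ℤ.*-comm (ρ x) (ρ y)) (sum-cong λ A → ℤ.*-comm (α A x) (α A y))

    adjacent one-big no-big : Weight N
    adjacent a b c d = ρ a * (ρ b * (π c * π d))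
    one-big  a b c d = π a * ρ c * τ b d
    no-big   a b c d = τ a c * τ b d

    -- Additivity of `P` is stated for its first argument. A half turn brings `ρ` there, where it
    -- splits into the sum of all `α B`.
    opposite : ∀ g A → P g (α A) ρ (α A) ≡ sum λ B → P g (α A) (α B) (α A)
    opposite g A = trans (P-half-turn g (α A) ρ (α A)) (trans
      (P-cong₁ (λ x → sym (sum-small (f x))) (α A) g (α A)) (trans
      (P-sum₁ α (α A) g (α A)) (sum-cong λ B → P-half-turn (α B) (α A) g (α A))))

    G-one-big : G one-big ≡ P π ρ ρ ρ - ∑² λ A B → P π (α A) (α B) (α A)
    G-one-big = begin
      G one-big
        ≡⟨ G-cong (λ a b c d → trans (arith₁ (π a) (ρ c) (ρ b) (ρ d) _)
             (cong (λ s → π a * (ρ b * (ρ c * ρ d)) - s) (trans (sum-*ˡ (π a * ρ c) _)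
               (sum-cong λ A → arith₂ (π a) (ρ c) (α A b) (α A d))))) ⟩
      G (λ a b c d → π a * (ρ b * (ρ c * ρ d)) - sum λ A → π a * (α A b * (ρ c * α A d)))
        ≡⟨ trans (G-- _ _) (cong (λ s → P π ρ ρ ρ - s) (G-sum (λ A a b c d → π a * (α A b * (ρ c * α A d))))) ⟩
      P π ρ ρ ρ - sum (λ A → P π (α A) ρ (α A))
        ≡⟨ cong (λ s → P π ρ ρ ρ - s) (sum-cong λ A → opposite π A) ⟩
      P π ρ ρ ρ - ∑² (λ A B → P π (α A) (α B) (α A)) ∎
      where
      arith₁ : ∀ pa rc rb rd s → pa * rc * (rb * rd - s) ≡ pa * (rb * (rc * rd)) - pa * rc * s
      arith₁ = solve-∀
      arith₂ : ∀ pa rc x y → pa * rc * (x * y) ≡ pa * (x * (rc * y))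
      arith₂ = solve-∀

    G-no-big : G no-big ≡ P ρ ρ ρ ρ - + 2 * ∑² (λ A B → P ρ (α A) (α B) (α A)) + ∑² (λ A B → P (α A) (α B) (α A) (α B))
    G-no-big = begin
      G no-big
        ≡⟨ G-cong (λ a b c d → trans (arith₁ (ρ a) (ρ b) (ρ c) (ρ d) _ _)
             (cong₂ _+_ (cong₂ _-_ (cong (λ s → ρ a * (ρ b * (ρ c * ρ d)) - s)
               (trans (sum-*ˡ (ρ a * ρ c) _) (sum-cong λ A → arith₂ (ρ a) (ρ c) (α A b) (α A d))))
               (trans (sum-*ʳ (ρ b * ρ d) _) (sum-cong λ A → arith₃ (α A a) (α A c) (ρ b) (ρ d))))
               (trans (sym (sum-product _ _)) (∑²-cong λ A B → arith₃ (α A a) (α A c) (α B b) (α B d))))) ⟩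
      G (λ a b c d → w₁ a b c d - sum (λ A → w₂ A a b c d) - sum (λ A → w₃ A a b c d) + ∑² (λ A B → w₄ A B a b c d))
        ≡⟨ trans (G-+ (λ a b c d → w₁ a b c d - sum (λ A → w₂ A a b c d) - sum (λ A → w₃ A a b c d)) _)
            (cong₂ _+_ (trans (G-- (λ a b c d → w₁ a b c d - sum (λ A → w₂ A a b c d)) _)
              (cong₂ _-_ (trans (G-- w₁ _) (cong (λ s → P ρ ρ ρ ρ - s) (G-sum w₂))) (G-sum w₃)))
              (trans (G-sum (λ A a b c d → sum λ B → w₄ A B a b c d)) (sum-cong λ A → G-sum (w₄ A)))) ⟩
      P ρ ρ ρ ρ - sum (λ A → P ρ (α A) ρ (α A)) - sum (λ A → P (α A) ρ (α A) ρ) + alternating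
        ≡⟨ cong (_+ alternating) (cong₂ (λ x y → P ρ ρ ρ ρ - x - y) (sum-cong λ A → opposite ρ A)
             (sum-cong λ A → trans (P-rotate (α A) ρ (α A) ρ) (opposite ρ A))) ⟩
      P ρ ρ ρ ρ - mono - mono + alternating
        ≡⟨ arith₄ (P ρ ρ ρ ρ) mono alternating ⟩
      P ρ ρ ρ ρ - + 2 * mono + alternating ∎
      where
      mono alternating : ℤ
      mono = ∑² λ A B → P ρ (α A) (α B) (α A)
      alternating = ∑² λ A B → P (α A) (α B) (α A) (α B)
      w₁ : Weight N
      w₁ a b c d = ρ a * (ρ b * (ρ c * ρ d))
      w₂ w₃ : Fin n → Weight N
      w₂ A a b c d = ρ a * (α A b * (ρ c * α A d))
      w₃ A a b c d = α A a * (ρ b * (α A c * ρ d))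
      w₄ : Fin n → Fin n → Weight N
      w₄ A B a b c d = α A a * (α B b * (α A c * α B d))
      arith₁ : ∀ ra rb rc rd s t → (ra * rc - t) * (rb * rd - s) ≡ ra * (rb * (rc * rd)) - ra * rc * s - t * (rb * rd) + t * s
      arith₁ = solve-∀
      arith₂ : ∀ ra rc x y → ra * rc * (x * y) ≡ ra * (x * (rc * y))
      arith₂ = solve-∀
      arith₃ : ∀ x y u v → x * y * (u * v) ≡ x * (u * (y * v))
      arith₃ = solve-∀
      arith₄ : ∀ a b c → a - b - b + c ≡ a - + 2 * b + c
      arith₄ = solve-∀

    -- An edge has at most one big end, so two big endpoints of a crossing pair are cyclic
    -- neighbours: this yields the four rotations of `adjacent`. One big endpoint gives the
    -- rotations of `one-big`, none gives `t * s`.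
    arith-E : ∀ pa pb pc pd ra rb rc rd t s →
      (pa * rc + pc * ra + t) * (pb * rd + pd * rb + s)
      ≡ (ra * (rb * (pc * pd)) + rb * (rc * (pd * pa)) + rc * (rd * (pa * pb)) + rd * (ra * (pb * pc)))
        + (pa * rc * s + pb * rd * t + pc * ra * s + pd * rb * t) + t * s
    arith-E = solve-∀

  -- 4ν, split by the number of endpoints in the big class.
  G-edges : G (λ a b c d → edge (f a) (f c) * edge (f b) (f d)) ≡
    + 4 * P ρ ρ π π + + 4 * (P π ρ ρ ρ - ∑² λ A B → P π (α A) (α B) (α A))
    + (P ρ ρ ρ ρ - + 2 * ∑² (λ A B → P ρ (α A) (α B) (α A)) + ∑² (λ A B → P (α A) (α B) (α A) (α B)))
  G-edges = begin
    G (λ a b c d → edge (f a) (f c) * edge (f b) (f d))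
      ≡⟨ G-cong (λ a b c d → trans (cong₂ _*_ (edge-decomposition (f a) (f c)) (edge-decomposition (f b) (f d)))
           (trans (arith-E (π a) (π b) (π c) (π d) (ρ a) (ρ b) (ρ c) (ρ d) (τ a c) (τ b d))
             (cong₂ (λ t s → orbit adjacent a b c d
                 + (π a * ρ c * τ b d + π b * ρ d * t + π c * ρ a * s + π d * ρ b * τ a c) + τ a c * τ b d)
               (τ-sym a c) (τ-sym b d)))) ⟩
    G (λ a b c d → orbit adjacent a b c d + orbit one-big a b c d + no-big a b c d)
      ≡⟨ trans (G-+ (λ a b c d → orbit adjacent a b c d + orbit one-big a b c d) no-big)
           (cong (_+ G no-big) (G-+ (orbit adjacent) (orbit one-big))) ⟩
    G (orbit adjacent) + G (orbit one-big) + G no-big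
      ≡⟨ cong₂ _+_ (cong₂ _+_ (G-orbit adjacent) (trans (G-orbit one-big) (cong (+ 4 *_) G-one-big))) G-no-big ⟩
    + 4 * P ρ ρ π π + + 4 * (P π ρ ρ ρ - ∑² λ A B → P π (α A) (α B) (α A))
    + (P ρ ρ ρ ρ - + 2 * ∑² (λ A B → P ρ (α A) (α B) (α A)) + ∑² (λ A B → P (α A) (α B) (α A) (α B))) ∎

  -- Equal to 2 in the big class, 1 in the other small classes and 0 in `A`. Summed over all ordered
  -- pairs of classes, the two alternating patterns coincide, which doubles 2 and 1 to the
  -- coefficients 4 and 2 in `G-edges`.
  weight : Fin n → Fin N → ℤ
  weight A x = + 1 + π x - α A x

  private
    P-weight : ∀ A g k l → P (weight A) g k l ≡ + 2 * P π g k l + P ρ g k l - P (α A) g k l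
    P-weight A g k l = begin
      P (weight A) g k l
        ≡⟨ trans (P-chord (weight A) g k l) (sum-cong λ c → expand (f c) (α A c) (K c g k l)) ⟩
      (sum λ c → + 2 * (π c * K c g k l) + ρ c * K c g k l - α A c * K c g k l)
        ≡⟨ trans (sum-- (λ c → + 2 * (π c * K c g k l) + ρ c * K c g k l) _)
             (cong₂ _-_ (trans (sum-+ (λ c → + 2 * (π c * K c g k l)) _) (cong₂ _+_
               (trans (sym (sum-*ˡ (+ 2) _)) (cong (+ 2 *_) (sym (P-chord π g k l)))) (sym (P-chord ρ g k l))))
               (sym (P-chord (α A) g k l))) ⟩
      + 2 * P π g k l + P ρ g k l - P (α A) g k l ∎
      where
      expand : ∀ (v : KVertex p m n) a k → (+ 1 + big v - a) * k ≡ + 2 * (big v * k) + rest v * k - a * k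
      expand (inj₁ _) = arith
        where
        arith : ∀ a k → (+ 1 + + 1 - a) * k ≡ + 2 * (+ 1 * k) + + 0 * k - a * k
        arith = solve-∀
      expand (inj₂ _) = arith
        where
        arith : ∀ a k → (+ 1 + + 0 - a) * k ≡ + 2 * (+ 0 * k) + + 1 * k - a * k
        arith = solve-∀

  -- Removing `α A` from the weight restores the quadruples A B A B, which occur in `G-edges` with a
  -- plus sign, and also the monochromatic triples. The latter depend only on the class sizes and
  -- are taken off separately.
  G-edges′ : G (λ a b c d → edge (f a) (f c) * edge (f b) (f d)) ≡
    + 4 * P ρ ρ π π + + 4 * P π ρ ρ ρ + P ρ ρ ρ ρ
    - ∑² (λ A B → P (weight A) (α A) (α B) (α A) + P (weight A) (α B) (α A) (α B))
    - sum (λ A → P ρ (α A) (α A) (α A))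
  G-edges′ = trans G-edges (trans
    (arith (P ρ ρ π π) (P π ρ ρ ρ) (P ρ ρ ρ ρ) Π R Alt Z)
    (cong (λ s → + 4 * P ρ ρ π π + + 4 * P π ρ ρ ρ + P ρ ρ ρ ρ - s - Z) (sym weighted)))
    where
    Π R Alt Z : ℤ
    Π   = ∑² λ A B → P π (α A) (α B) (α A)
    R   = ∑² λ A B → P ρ (α A) (α B) (α A)
    Alt = ∑² λ A B → P (α A) (α B) (α A) (α B)
    Z   = sum λ A → P ρ (α A) (α A) (α A)

    arith : ∀ x y z Π R Alt Z → + 4 * x + + 4 * (y - Π) + (z - + 2 * R + Alt)
      ≡ + 4 * x + + 4 * y + z - (+ 2 * (Π + Π) + (R + R) - (Z + Alt)) - Z
    arith = solve-∀

    pairs : (Fin n → (Fin N → ℤ)) → Fin n → Fin n → ℤ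
    pairs g A B = P (g A) (α A) (α B) (α A) + P (g A) (α B) (α A) (α B)

    pairs-fixed : ∀ g → ∑² (pairs λ _ → g) ≡ ∑² (λ A B → P g (α A) (α B) (α A)) + ∑² (λ A B → P g (α A) (α B) (α A))
    pairs-fixed g = trans (∑²-+ _ _) (cong (λ s → ∑² (λ A B → P g (α A) (α B) (α A)) + s)
      (∑²-swap λ A B → P g (α A) (α B) (α A)))

    triples : ∑² (λ A B → P (α A) (α A) (α B) (α A)) ≡ Z
    triples = sum-cong λ A → trans
      (sum-cong λ B → P-half-turn (α A) (α A) (α B) (α A))
      (trans (sym (P-sum₁ α (α A) (α A) (α A))) (P-cong₁ (λ x → sum-small (f x)) (α A) (α A) (α A)))

    weighted : ∑² (pairs weight) ≡ + 2 * (Π + Π) + (R + R) - (Z + Alt)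
    weighted = begin
      ∑² (pairs weight)
        ≡⟨ ∑²-cong (λ A B → trans (cong₂ _+_ (P-weight A (α A) (α B) (α A)) (P-weight A (α B) (α A) (α B)))
             (regroup (P π (α A) (α B) (α A)) (P ρ (α A) (α B) (α A)) (P (α A) (α A) (α B) (α A))
                      (P π (α B) (α A) (α B)) (P ρ (α B) (α A) (α B)) (P (α A) (α B) (α A) (α B)))) ⟩
      ∑² (λ A B → + 2 * pairs (λ _ → π) A B + pairs (λ _ → ρ) A B - pairs α A B)
        ≡⟨ trans (∑²-- (λ A B → + 2 * pairs (λ _ → π) A B + pairs (λ _ → ρ) A B) (pairs α))
             (cong₂ _-_ (trans (∑²-+ (λ A B → + 2 * pairs (λ _ → π) A B) (pairs λ _ → ρ))
                (cong₂ _+_ (trans (sym (∑²-*ˡ (+ 2) (pairs λ _ → π))) (cong (+ 2 *_) (pairs-fixed π))) (pairs-fixed ρ)))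
                (trans (∑²-+ _ _) (cong (_+ Alt) triples))) ⟩
      + 2 * (Π + Π) + (R + R) - (Z + Alt) ∎
      where
      regroup : ∀ a b c a′ b′ c′ → (+ 2 * a + b - c) + (+ 2 * a′ + b′ - c′) ≡ + 2 * (a + a′) + (b + b′) - (c + c′)
      regroup = solve-∀

-- Counting vertices

sum-↑ : ∀ a b (f : Fin (a ℕ.+ b) → ℤ) → sum f ≡ sum (λ i → f (i ↑ˡ b)) + sum (λ j → f (a ↑ʳ j))
sum-↑ zero    b f = sym (trans (cong (_+ sum f) (sum-[] _)) (ℤ.+-identityˡ (sum f)))
sum-↑ (suc a) b f = trans (sum-∷ f) (trans (cong (λ s → f zero + s) (sum-↑ a b (f ∘ suc)))
  (trans (sym (ℤ.+-assoc (f zero) _ _)) (cong (_+ sum (λ j → f (suc a ↑ʳ j))) (sym (sum-∷ _)))))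

sum-combine : ∀ a b (f : Fin (a ℕ.* b) → ℤ) → sum f ≡ sum λ i → sum λ j → f (combine {a} {b} i j)
sum-combine zero    b f = trans (sum-[] f) (sym (sum-[] _))
sum-combine (suc a) b f = trans (sum-↑ b (a ℕ.* b) f)
  (trans (cong (λ s → sum (λ j → f (j ↑ˡ (a ℕ.* b))) + s) (sum-combine a b (λ k → f (b ↑ʳ k)))) (sym (sum-∷ _)))

module _ {p m n : ℕ} where

  enumeration : OuterplanarDrawing p m n
  enumeration = ↔-trans (Fin.+↔⊎ {p}) (↔-refl ⊎-↔ Fin.*↔× {n})

  -- Any two drawings differ by a permutation of the positions, so totals can be read off one fixed
  -- enumeration.
  sum-vertices : ∀ (D : OuterplanarDrawing p m n) (g : KVertex p m n → ℤ) →
    sum (λ x → g (Inverse.to D x)) ≡ sum (λ i → g (inj₁ i)) + sum (λ a → sum λ i → g (inj₂ (a , i)))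
  sum-vertices D g = begin
    sum (λ x → g (Inverse.to D x))
      ≡⟨ sum-cong (λ x → cong g (sym (Inverse.strictlyInverseˡ enumeration (Inverse.to D x)))) ⟩
    sum (λ x → g (Inverse.to enumeration (Inverse.from enumeration (Inverse.to D x))))
      ≡⟨ sym (sum-permute (g ∘ Inverse.to enumeration) (↔-trans D (↔-sym enumeration))) ⟩
    sum (g ∘ Inverse.to enumeration)
      ≡⟨ trans (sum-↑ p (n ℕ.* m) _) (cong (λ s → sum (λ i → g (Inverse.to enumeration (i ↑ˡ (n ℕ.* m)))) + s) (sum-combine n m _)) ⟩
    sum (λ i → g (Inverse.to enumeration (i ↑ˡ (n ℕ.* m)))) + sum (λ a → sum λ i → g (Inverse.to enumeration (p ↑ʳ combine a i)))
      ≡⟨ cong₂ _+_ (sum-cong λ i → cong g (left-part i)) (sum-cong λ a → sum-cong λ i → cong g (right-part a i)) ⟩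
    sum (λ i → g (inj₁ i)) + sum (λ a → sum λ i → g (inj₂ (a , i))) ∎
    where
    left-part : ∀ i → Inverse.to enumeration (i ↑ˡ (n ℕ.* m)) ≡ inj₁ i
    left-part i rewrite Fin.splitAt-↑ˡ p i (n ℕ.* m) = refl
    right-part : ∀ a i → Inverse.to enumeration (p ↑ʳ combine a i) ≡ inj₂ (a , i)
    right-part a i rewrite Fin.splitAt-↑ʳ p (n ℕ.* m) (combine a i) = cong inj₂ (Fin.remQuot-combine a i)

-- The identity for 24ν

module Identity {p m n : ℕ} (q : ℤ) (p≡ : + p ≡ q * (+ n * + m)) (D : OuterplanarDrawing p m n) where

  open Decomposition {p = p} {m} {n} (Inverse.to D) public

  private
    f = Inverse.to D
    M r : ℤ
    M = + m
    r = + n * + m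

  sum-π : sum π ≡ + p
  sum-π = begin
    sum π
      ≡⟨ sum-vertices D big ⟩
    sum {p} (λ _ → + 1) + sum {n} (λ _ → sum {m} λ _ → + 0)
      ≡⟨ cong₂ _+_ (trans (sum-const p (+ 1)) (ℤ.*-identityʳ (+ p))) (trans (sum-cong λ _ → sum-zero m) (sum-zero n)) ⟩
    + p + + 0
      ≡⟨ ℤ.+-identityʳ (+ p) ⟩
    + p ∎

  sum-ρ : sum ρ ≡ r
  sum-ρ = begin
    sum ρ
      ≡⟨ sum-vertices D rest ⟩
    sum {p} (λ _ → + 0) + sum {n} (λ _ → sum {m} λ _ → + 1)
      ≡⟨ cong₂ _+_ (sum-zero p) (trans (sum-cong λ _ → trans (sum-const m (+ 1)) (ℤ.*-identityʳ M)) (sum-const n M)) ⟩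
    + 0 + r
      ≡⟨ ℤ.+-identityˡ r ⟩
    r ∎

  sum-α : ∀ A → sum (α A) ≡ M
  sum-α A = begin
    sum (α A)
      ≡⟨ sum-vertices D (small A) ⟩
    sum {p} (λ _ → + 0) + sum (λ a → sum {m} λ _ → δ a A)
      ≡⟨ cong₂ _+_ (sum-zero p) (trans (sum-cong λ a → trans (sum-const m (δ a A)) (trans (ℤ.*-comm M (δ a A)) (cong (_* M) (δ-sym a A))))
           (sum-δ A (λ _ → M))) ⟩
    + 0 + M
      ≡⟨ ℤ.+-identityˡ M ⟩
    M ∎

  spread : ℤ
  spread = sum λ c → ρ c * drift-defect ρ π q c

  disorder : Fin n → Fin n → ℤ
  disorder A B = sum λ c → weight A c * defect (α A) (α B) c

  -- `weight A` vanishes on the class `A`, so `c` may be assumed to lie outside it, as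
  -- `K-alternating` demands.
  on-weight : ∀ A c {x y} → (α A c ≡ + 0 → x ≡ y) → weight A c * x ≡ weight A c * y
  on-weight A c {x} {y} h = go (f c) h
    where
    go : ∀ v → (small A v ≡ + 0 → x ≡ y) → (+ 1 + big v - small A v) * x ≡ (+ 1 + big v - small A v) * y
    go (inj₁ _) h = cong (+ 2 *_) (h refl)
    go (inj₂ (a , _)) h = by-bit (δ-bit a A) h
      where
      by-bit : ∀ {s} → Bit s → (s ≡ + 0 → x ≡ y) → (+ 1 + + 0 - s) * x ≡ (+ 1 + + 0 - s) * y
      by-bit (inj₁ refl) h = cong (+ 1 *_) (h refl)
      by-bit (inj₂ refl) _ = trans (ℤ.*-zeroˡ x) (sym (ℤ.*-zeroˡ y))

  private
    X Y γ : ℤ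
    X = + 2 * ((M - + 1) * M * (M + + 1))
    Y = M * (M - + 1)
    γ = + p + r + + p - M

    sum-weight : ∀ A → sum (weight A) ≡ γ
    sum-weight A = begin
      sum (weight A)
        ≡⟨ trans (sum-- (λ c → + 1 + π c) (α A)) (cong₂ _-_ (trans (sum-+ (λ _ → + 1) π)
             (cong₂ _+_ (trans (sum-const (order p m n) (+ 1)) (ℤ.*-identityʳ (+ order p m n))) sum-π)) (sum-α A)) ⟩
      + order p m n + + p - M
        ≡⟨ cong (λ s → + p + s + + p - M) (ℤ.pos-* n m) ⟩
      γ ∎

    sum-weight-α : ∀ A B → sum (λ c → weight A c * α B c) ≡ M - δ A B * M
    sum-weight-α A B = begin
      sum (λ c → weight A c * α B c)
        ≡⟨ sum-cong (λ c → pointwise (f c)) ⟩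
      sum (λ c → α B c - δ A B * α A c)
        ≡⟨ trans (sum-- (α B) _) (cong₂ _-_ (sum-α B) (trans (sym (sum-*ˡ (δ A B) (α A))) (cong (δ A B *_) (sum-α A)))) ⟩
      M - δ A B * M ∎
      where
      pointwise : ∀ v → (+ 1 + big v - small A v) * small B v ≡ small B v - δ A B * small A v
      pointwise (inj₁ _) = cong (λ s → + 0 - s) (sym (ℤ.*-zeroʳ (δ A B)))
      pointwise (inj₂ (a , _)) with a ≟ A
      ... | yes refl = arith (δ a B)
        where
        arith : ∀ b → (+ 1 + + 0 - + 1) * b ≡ b - b * + 1
        arith = solve-∀
      ... | no  _ = arith (δ a B) (δ A B)
        where
        arith : ∀ b d → (+ 1 + + 0 - + 0) * b ≡ b - d * + 0
        arith = solve-∀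

    -- The cases A = B and A ≠ B differ only in the `δ A B` term, which lets the sum over all pairs
    -- be taken uniformly.
    K-pair : ∀ A B c → α A c ≡ + 0 →
      + 6 * (K c (α A) (α B) (α A) + K c (α B) (α A) (α B)) ≡ X - + 3 * (α B c * Y) - + 6 * (δ A B * Y) - + 6 * defect (α A) (α B) c
    K-pair A B c αc≡0 with A ≟ B
    ... | yes refl = trans (K-alternating-self (α A) M (λ y → small-bit A (f y)) (sum-α A) c αc≡0)
                           (cong (λ y → X - + 3 * (α A c * Y) - + 6 * y - + 6 * defect (α A) (α A) c) (sym (ℤ.*-identityˡ Y)))
    ... | no A≢B   = trans (K-alternating (α A) (α B) M (λ y → small-exclusive A≢B (f y)) (sum-α A) (sum-α B) c αc≡0)
                           (arith (X - + 3 * (α B c * Y)) Y (defect (α A) (α B) c))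
      where
      arith : ∀ x y d → x - + 6 * d ≡ x - + 6 * (+ 0 * y) - + 6 * d
      arith = solve-∀

    P-pair : ∀ A B → + 6 * (P (weight A) (α A) (α B) (α A) + P (weight A) (α B) (α A) (α B))
      ≡ X * γ - + 3 * (M * Y) + δ A B * (+ 3 * (M * Y) - + 6 * (Y * γ)) - + 6 * disorder A B
    P-pair A B = begin
      + 6 * (P (weight A) (α A) (α B) (α A) + P (weight A) (α B) (α A) (α B))
        ≡⟨ cong (+ 6 *_) (trans (cong₂ _+_ (P-chord (weight A) (α A) (α B) (α A)) (P-chord (weight A) (α B) (α A) (α B)))
             (sym (sum-+ (λ c → weight A c * K c (α A) (α B) (α A)) (λ c → weight A c * K c (α B) (α A) (α B))))) ⟩
      + 6 * sum (λ c → weight A c * K c (α A) (α B) (α A) + weight A c * K c (α B) (α A) (α B))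
        ≡⟨ trans (sum-*ˡ (+ 6) _) (sum-cong λ c → trans (arith₁ (weight A c) (K c (α A) (α B) (α A)) (K c (α B) (α A) (α B))) (trans (on-weight A c (K-pair A B c))
             (arith₂ (weight A c) X (α B c) Y (δ A B) (defect (α A) (α B) c)))) ⟩
      sum (λ c → (X - + 6 * (δ A B * Y)) * weight A c - + 3 * Y * (weight A c * α B c) - + 6 * (weight A c * defect (α A) (α B) c))
        ≡⟨ trans (sum-- (λ c → (X - + 6 * (δ A B * Y)) * weight A c - + 3 * Y * (weight A c * α B c)) _) (cong₂ _-_
             (trans (sum-- (λ c → (X - + 6 * (δ A B * Y)) * weight A c) _) (cong₂ _-_
               (trans (sym (sum-*ˡ (X - + 6 * (δ A B * Y)) (weight A))) (cong ((X - + 6 * (δ A B * Y)) *_) (sum-weight A)))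
               (trans (sym (sum-*ˡ (+ 3 * Y) _)) (cong (+ 3 * Y *_) (sum-weight-α A B)))))
             (sym (sum-*ˡ (+ 6) _))) ⟩
      (X - + 6 * (δ A B * Y)) * γ - + 3 * Y * (M - δ A B * M) - + 6 * disorder A B
        ≡⟨ cong (_- + 6 * disorder A B) (arith₃ X Y γ M (δ A B)) ⟩
      X * γ - + 3 * (M * Y) + δ A B * (+ 3 * (M * Y) - + 6 * (Y * γ)) - + 6 * disorder A B ∎
      where
      arith₁ : ∀ w j k → + 6 * (w * j + w * k) ≡ w * (+ 6 * (j + k))
      arith₁ = solve-∀
      arith₂ : ∀ w x b y d u → w * (x - + 3 * (b * y) - + 6 * (d * y) - + 6 * u)
        ≡ (x - + 6 * (d * y)) * w - + 3 * y * (w * b) - + 6 * (w * u)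
      arith₂ = solve-∀
      arith₃ : ∀ x y g m d → (x - + 6 * (d * y)) * g - + 3 * y * (m - d * m)
        ≡ x * g - + 3 * (m * y) + d * (+ 3 * (m * y) - + 6 * (y * g))
      arith₃ = solve-∀

    P-pairs : + 6 * ∑² (λ A B → P (weight A) (α A) (α B) (α A) + P (weight A) (α B) (α A) (α B))
      ≡ + n * (+ n * (X * γ - + 3 * (M * Y)) + (+ 3 * (M * Y) - + 6 * (Y * γ))) - + 6 * ∑² disorder
    P-pairs = begin
      + 6 * ∑² (λ A B → P (weight A) (α A) (α B) (α A) + P (weight A) (α B) (α A) (α B))
        ≡⟨ trans (∑²-*ˡ (+ 6) _) (∑²-cong P-pair) ⟩
      ∑² (λ A B → c₀ + δ A B * c₁ - + 6 * disorder A B)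
        ≡⟨ trans (∑²-- (λ A B → c₀ + δ A B * c₁) _) (cong₂ _-_
             (trans (sum-cong λ A → trans (sum-+ (λ _ → c₀) _) (cong₂ _+_ (sum-const n c₀) (sum-δ A (λ _ → c₁)))) (sum-const n _))
             (sym (∑²-*ˡ (+ 6) disorder))) ⟩
      + n * (+ n * c₀ + c₁) - + 6 * ∑² disorder ∎
      where
      c₀ c₁ : ℤ
      c₀ = X * γ - + 3 * (M * Y)
      c₁ = + 3 * (M * Y) - + 6 * (Y * γ)

    P-one-big : + 6 * P π ρ ρ ρ ≡ + p * (r * (r - + 1) * (r - + 2))
    P-one-big = trans (P-self π ρ (λ y → rest-bit (f y))) (trans
      (sum-cong λ c → trans (cong (λ s → π c * ((s - ρ c) * (s - ρ c - + 1) * (s - ρ c - + 2))) sum-ρ) (pointwise (f c)))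
      (trans (sym (sum-*ʳ _ π)) (cong (_* (r * (r - + 1) * (r - + 2))) sum-π)))
      where
      pointwise : ∀ (v : KVertex p m n) → big v * ((r - rest v) * (r - rest v - + 1) * (r - rest v - + 2)) ≡ big v * (r * (r - + 1) * (r - + 2))
      pointwise (inj₁ _) = arith r
        where
        arith : ∀ r → + 1 * ((r - + 0) * (r - + 0 - + 1) * (r - + 0 - + 2)) ≡ + 1 * (r * (r - + 1) * (r - + 2))
        arith = solve-∀
      pointwise (inj₂ _) = refl

    P-rest : + 6 * P ρ ρ ρ ρ ≡ r * ((r - + 1) * (r - + 2) * (r - + 3))
    P-rest = trans (P-self ρ ρ (λ y → rest-bit (f y))) (trans
      (sum-cong λ c → trans (cong (λ s → ρ c * ((s - ρ c) * (s - ρ c - + 1) * (s - ρ c - + 2))) sum-ρ) (pointwise (f c)))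
      (trans (sym (sum-*ʳ _ ρ)) (cong (_* ((r - + 1) * (r - + 2) * (r - + 3))) sum-ρ)))
      where
      pointwise : ∀ (v : KVertex p m n) → rest v * ((r - rest v) * (r - rest v - + 1) * (r - rest v - + 2)) ≡ rest v * ((r - + 1) * (r - + 2) * (r - + 3))
      pointwise (inj₁ _) = refl
      pointwise (inj₂ _) = arith r
        where
        arith : ∀ r → + 1 * ((r - + 1) * (r - + 1 - + 1) * (r - + 1 - + 2)) ≡ + 1 * ((r - + 1) * (r - + 2) * (r - + 3))
        arith = solve-∀

    P-triple : ∀ A → + 6 * P ρ (α A) (α A) (α A) ≡ r * (M * (M - + 1) * (M - + 2)) - + 3 * ((M - + 1) * (M - + 2)) * M
    P-triple A = trans (P-self ρ (α A) (λ y → small-bit A (f y))) (trans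
      (sum-cong λ c → trans (cong (λ s → ρ c * ((s - α A c) * (s - α A c - + 1) * (s - α A c - + 2))) (sum-α A)) (pointwise (f c)))
      (trans (sum-- (λ c → ρ c * (M * (M - + 1) * (M - + 2))) _) (cong₂ _-_
        (trans (sym (sum-*ʳ _ ρ)) (cong (_* (M * (M - + 1) * (M - + 2))) sum-ρ))
        (trans (sym (sum-*ˡ (+ 3 * ((M - + 1) * (M - + 2))) (α A))) (cong (+ 3 * ((M - + 1) * (M - + 2)) *_) (sum-α A))))))
      where
      -- The subtracted 3 (M - 1) (M - 2) is M (M - 1) (M - 2) minus (M - 1) (M - 2) (M - 3), the
      -- loss when the first vertex itself belongs to `A`.
      pointwise : ∀ v → rest v * ((M - small A v) * (M - small A v - + 1) * (M - small A v - + 2))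
        ≡ rest v * (M * (M - + 1) * (M - + 2)) - + 3 * ((M - + 1) * (M - + 2)) * small A v
      pointwise (inj₁ _) = arith M
        where
        arith : ∀ m → + 0 * ((m - + 0) * (m - + 0 - + 1) * (m - + 0 - + 2)) ≡ + 0 * (m * (m - + 1) * (m - + 2)) - + 3 * ((m - + 1) * (m - + 2)) * + 0
        arith = solve-∀
      pointwise (inj₂ (a , _)) with δ a A | δ-bit a A
      ... | _ | inj₁ refl = arith M
        where
        arith : ∀ m → + 1 * ((m - + 0) * (m - + 0 - + 1) * (m - + 0 - + 2)) ≡ + 1 * (m * (m - + 1) * (m - + 2)) - + 3 * ((m - + 1) * (m - + 2)) * + 0
        arith = solve-∀
      ... | _ | inj₂ refl = arith M
        where
        arith : ∀ m → + 1 * ((m - + 1) * (m - + 1 - + 1) * (m - + 1 - + 2)) ≡ + 1 * (m * (m - + 1) * (m - + 2)) - + 3 * ((m - + 1) * (m - + 2)) * + 1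
        arith = solve-∀

    S : ℤ
    S = q * q * ((r - + 1) * r * (+ 2 * r - + 1)) - + 3 * q * (r * (r - + 1))

    closed-form : + 2 * (r * S) + + 4 * (+ p * (r * (r - + 1) * (r - + 2))) + r * ((r - + 1) * (r - + 2) * (r - + 3))
      - + n * (+ n * (X * γ - + 3 * (M * Y)) + (+ 3 * (M * Y) - + 6 * (Y * γ)))
      - + n * (r * (M * (M - + 1) * (M - + 2)) - + 3 * ((M - + 1) * (M - + 2)) * M)
      ≡ rhs24 m n p
    -- Both `p` and q occur, and the equality depends on p = q n m. Substituting for `p` makes it a
    -- polynomial identity in m, n and q; afterwards `p` is put back to recover `rhs24`.
    closed-form = trans (cong (λ P → value P) p≡) (trans (polynomial M (+ n) q) (cong (λ P → target P) (sym p≡)))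
      where
      value target : ℤ → ℤ
      value P = + 2 * (r * S) + + 4 * (P * (r * (r - + 1) * (r - + 2))) + r * ((r - + 1) * (r - + 2) * (r - + 3))
        - + n * (+ n * (X * (P + r + P - M) - + 3 * (M * Y)) + (+ 3 * (M * Y) - + 6 * (Y * (P + r + P - M))))
        - + n * (r * (M * (M - + 1) * (M - + 2)) - + 3 * ((M - + 1) * (M - + 2)) * M)
      N : ℤ
      N = + n
      target P =
          ( M ^ 4 * N ^ 4 + + 2 * M ^ 2 * N ^ 3 - + 2 * M ^ 4 * N ^ 3
          - + 6 * M ^ 3 * N ^ 3 + + 12 * M ^ 3 * N ^ 2 + M ^ 4 * N ^ 2
          - + 6 * M ^ 3 * N
          + + 4 * M ^ 2 * N ^ 2 * P ^ 2 - + 6 * P ^ 2 * M * N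
          - + 18 * M ^ 2 * N ^ 2 * P + + 2 * M * N * P + + 12 * M ^ 2 * N * P
          - + 4 * M ^ 3 * N ^ 2 * P + + 4 * M ^ 3 * N ^ 3 * P + + 4 * M * N ^ 2 * P )
          - + 2 * M ^ 2 * N ^ 2 + + 2 * P ^ 2
      -- The right-hand side is rhs24 with the powers written out for the solver.
      polynomial : ∀ M N Q →
        + 2 * ((N * M) * (Q * Q * ((N * M - + 1) * (N * M) * (+ 2 * (N * M) - + 1)) - + 3 * Q * ((N * M) * (N * M - + 1))))
        + + 4 * (Q * (N * M) * ((N * M) * (N * M - + 1) * (N * M - + 2))) + (N * M) * ((N * M - + 1) * (N * M - + 2) * (N * M - + 3))
        - N * (N * (+ 2 * ((M - + 1) * M * (M + + 1)) * (Q * (N * M) + N * M + Q * (N * M) - M) - + 3 * (M * (M * (M - + 1))))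
          + (+ 3 * (M * (M * (M - + 1))) - + 6 * (M * (M - + 1) * (Q * (N * M) + N * M + Q * (N * M) - M))))
        - N * ((N * M) * (M * (M - + 1) * (M - + 2)) - + 3 * ((M - + 1) * (M - + 2)) * M)
        ≡ ( M * (M * (M * (M * + 1))) * (N * (N * (N * (N * + 1)))) + + 2 * (M * (M * + 1)) * (N * (N * (N * + 1))) - + 2 * (M * (M * (M * (M * + 1)))) * (N * (N * (N * + 1)))
          - + 6 * (M * (M * (M * + 1))) * (N * (N * (N * + 1))) + + 12 * (M * (M * (M * + 1))) * (N * (N * + 1)) + M * (M * (M * (M * + 1))) * (N * (N * + 1))
          - + 6 * (M * (M * (M * + 1))) * N
          + + 4 * (M * (M * + 1)) * (N * (N * + 1)) * (Q * (N * M) * (Q * (N * M) * + 1)) - + 6 * (Q * (N * M) * (Q * (N * M) * + 1)) * M * N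
          - + 18 * (M * (M * + 1)) * (N * (N * + 1)) * (Q * (N * M)) + + 2 * M * N * (Q * (N * M)) + + 12 * (M * (M * + 1)) * N * (Q * (N * M))
          - + 4 * (M * (M * (M * + 1))) * (N * (N * + 1)) * (Q * (N * M)) + + 4 * (M * (M * (M * + 1))) * (N * (N * (N * + 1))) * (Q * (N * M)) + + 4 * M * (N * (N * + 1)) * (Q * (N * M)) )
          - + 2 * (M * (M * + 1)) * (N * (N * + 1)) + + 2 * (Q * (N * M) * (Q * (N * M) * + 1))
      polynomial = solve-∀

  -- 24ν is six times 4ν. `P-adjacent` enters doubled, so its 6 becomes the 12 before `spread`.
  -- `disorder` comes with a plus sign because it lowers the number of alternating patterns, which
  -- are themselves subtracted.
  crossings-identity : + 24 * + crossings D ≡ rhs24 m n p + (+ 12 * spread + + 6 * ∑² disorder)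
  crossings-identity = begin
    + 24 * + crossings D
      ≡⟨ arith₁ (+ crossings D) ⟩
    + 6 * (+ 4 * + crossings D)
      ≡⟨ cong (+ 6 *_) (trans (cong (+ 4 *_) (crossingsOf-chain adj f)) (trans (sym (G-linear _ invariant)) G-edges′)) ⟩
    + 6 * (+ 4 * P ρ ρ π π + + 4 * P π ρ ρ ρ + P ρ ρ ρ ρ
      - ∑² (λ A B → P (weight A) (α A) (α B) (α A) + P (weight A) (α B) (α A) (α B)) - sum (λ A → P ρ (α A) (α A) (α A)))
      ≡⟨ arith₂ (P ρ ρ π π) (P π ρ ρ ρ) (P ρ ρ ρ ρ) _ _ ⟩
    + 2 * (+ 12 * P ρ ρ π π) + + 4 * (+ 6 * P π ρ ρ ρ) + + 6 * P ρ ρ ρ ρ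
      - + 6 * ∑² (λ A B → P (weight A) (α A) (α B) (α A) + P (weight A) (α B) (α A) (α B)) - + 6 * sum (λ A → P ρ (α A) (α A) (α A))
      ≡⟨ cong₂ _-_ (cong₂ _-_ (cong₂ _+_ (cong₂ (λ x y → + 2 * x + + 4 * y)
           (P-adjacent ρ π r q (λ y → rest-big-exclusive (f y)) sum-ρ (trans sum-π p≡)) P-one-big) P-rest) P-pairs)
           (trans (sum-*ˡ (+ 6) _) (trans (sum-cong P-triple) (sum-const n _))) ⟩
    + 2 * (r * S + + 6 * spread) + + 4 * (+ p * (r * (r - + 1) * (r - + 2))) + r * ((r - + 1) * (r - + 2) * (r - + 3))
      - (u - + 6 * ∑² disorder) - v
      ≡⟨ arith₃ (r * S) spread (+ 4 * (+ p * (r * (r - + 1) * (r - + 2)))) (r * ((r - + 1) * (r - + 2) * (r - + 3))) u (∑² disorder) v ⟩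
    + 2 * (r * S) + + 4 * (+ p * (r * (r - + 1) * (r - + 2))) + r * ((r - + 1) * (r - + 2) * (r - + 3)) - u - v + (+ 12 * spread + + 6 * ∑² disorder)
      ≡⟨ cong (_+ (+ 12 * spread + + 6 * ∑² disorder)) closed-form ⟩
    rhs24 m n p + (+ 12 * spread + + 6 * ∑² disorder) ∎
    where
    u v : ℤ
    u = + n * (+ n * (X * γ - + 3 * (M * Y)) + (+ 3 * (M * Y) - + 6 * (Y * γ)))
    v = + n * (r * (M * (M - + 1) * (M - + 2)) - + 3 * ((M - + 1) * (M - + 2)) * M)
    invariant : ∀ a b c d → edge (f a) (f c) * edge (f b) (f d) ≡ edge (f b) (f d) * edge (f c) (f a)
    invariant a b c d = trans (ℤ.*-comm (edge (f a) (f c)) _) (cong (edge (f b) (f d) *_) (edge-sym (f a) (f c)))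
    arith₁ : ∀ x → + 24 * x ≡ + 6 * (+ 4 * x)
    arith₁ = solve-∀
    arith₂ : ∀ a b c d e → + 6 * (+ 4 * a + + 4 * b + c - d - e) ≡ + 2 * (+ 12 * a) + + 4 * (+ 6 * b) + + 6 * c - + 6 * d - + 6 * e
    arith₂ = solve-∀
    arith₃ : ∀ a s b c u d v → + 2 * (a + + 6 * s) + b + c - (u - + 6 * d) - v ≡ + 2 * a + b + c - u - v + (+ 12 * s + + 6 * d)
    arith₃ = solve-∀

-- Nonnegativity

-- A witness instead of an inequality: closure under sums and products is computed on witnesses, and
-- the final witness is the slack in the comparison of natural numbers.
IsNat : ℤ → Set
IsNat x = ∃ λ k → x ≡ + k

IsNat-+ : ∀ {x y} → IsNat x → IsNat y → IsNat (x + y)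
IsNat-+ (j , refl) (k , refl) = j ℕ.+ k , refl

IsNat-* : ∀ {x y} → IsNat x → IsNat y → IsNat (x * y)
IsNat-* (j , refl) (k , refl) = j ℕ.* k , sym (ℤ.pos-* j k)

IsNat-sum : ∀ {n} (f : Fin n → ℤ) → (∀ i → IsNat (f i)) → IsNat (sum f)
IsNat-sum {zero}  f h = 0 , sum-[] f
IsNat-sum {suc n} f h = subst IsNat (sym (sum-∷ f)) (IsNat-+ (h zero) (IsNat-sum (f ∘ suc) (h ∘ suc)))

IsNat-bit : ∀ {x} → Bit x → IsNat x
IsNat-bit (inj₁ refl) = 0 , refl
IsNat-bit (inj₂ refl) = 1 , refl

IsNat-square : ∀ x → IsNat (x * x)
IsNat-square (+ k)      = k ℕ.* k , sym (ℤ.pos-* k k)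
IsNat-square (-[1+ k ]) = suc k ℕ.* suc k , refl

IsNat-distinct : ∀ {n} (i j : Fin n) → IsNat (distinct i j)
IsNat-distinct i j with δ i j | δ-bit i j
... | _ | inj₁ refl = 1 , refl
... | _ | inj₂ refl = 0 , refl

-- (e − 1)(e − b) ≥ 0 because no integer lies strictly between 0 and 1.
IsNat-gap : ∀ e {b} → Bit b → IsNat ((e - + 1) * (e - b))
IsNat-gap e               (inj₂ refl) = IsNat-square (e - + 1)
IsNat-gap (+ zero)        (inj₁ refl) = 0 , refl
IsNat-gap (+ suc k)       (inj₁ refl) = k ℕ.* suc (k ℕ.+ 0) , sym (ℤ.pos-* k (suc (k ℕ.+ 0)))
IsNat-gap (-[1+ k ])      (inj₁ refl) = suc (suc (k ℕ.+ 0)) ℕ.* suc k , refl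

module _ {p m n : ℕ} (q : ℤ) (p≡ : + p ≡ q * (+ n * + m)) (D : OuterplanarDrawing p m n) where
  open Identity q p≡ D

  crossings-excess : IsNat (+ 12 * spread + + 6 * ∑² disorder)
  crossings-excess = IsNat-+ (IsNat-* (12 , refl) spread-nat) (IsNat-* (6 , refl) disorder-nat)
    where
    spread-nat : IsNat spread
    spread-nat = IsNat-sum _ λ c → IsNat-* (IsNat-bit (rest-bit (Inverse.to D c))) (IsNat-sum _ λ y →
      IsNat-* (IsNat-distinct c y) (IsNat-* (IsNat-bit (rest-bit (Inverse.to D y))) (IsNat-square (drift ρ π q y - drift ρ π q c))))
    weight-nat : ∀ A v → IsNat (+ 1 + big v - small {p} {m} A v)
    weight-nat A (inj₁ _)       = 2 , refl
    weight-nat A (inj₂ (a , _)) = IsNat-distinct a A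
    disorder-nat : IsNat (∑² disorder)
    disorder-nat = IsNat-sum _ λ A → IsNat-sum _ λ B → IsNat-sum _ λ c →
      IsNat-* (weight-nat A (Inverse.to D c)) (IsNat-sum _ λ y → IsNat-* (IsNat-distinct c y)
        (IsNat-* (IsNat-bit (small-bit A (Inverse.to D y)))
          (IsNat-gap (excess (α A) (α B) y - excess (α A) (α B) c) (small-bit B (Inverse.to D c)))))

-- The optimal drawing

-- Positional comparison in base d: the leading part decides, and only the last digit of the smaller
-- number has to be below d.
lex-< : ∀ {d u v s} t → s ℕ.< d → u ℕ.< v → d ℕ.* u ℕ.+ s ℕ.< d ℕ.* v ℕ.+ t
lex-< {d} {u} {v} {s} t s<d u<v = ℕ.<-≤-trans (ℕ.+-monoʳ-< (d ℕ.* u) s<d)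
  (ℕ.≤-trans (ℕ.≤-reflexive (trans (ℕ.+-comm (d ℕ.* u) d) (sym (ℕ.*-suc d u))))
    (ℕ.≤-trans (ℕ.*-monoʳ-≤ d u<v) (ℕ.m≤m+n (d ℕ.* v) t)))

lt-+ˡ : ∀ c a b → lt (c ℕ.+ a) (c ℕ.+ b) ≡ lt a b
lt-+ˡ zero    a b = refl
lt-+ˡ (suc c) a b = lt-+ˡ c a b

lt-bit : ∀ a b → Bit (lt a b)
lt-bit a b with a ℕ.<? b
... | yes a<b = inj₂ (lt-true a<b)
... | no  a≮b = inj₁ (lt-false a≮b)

prefix-cong : ∀ {N} {f g : Fin N → ℤ} → (∀ x → f x ≡ g x) → ∀ k → prefix f k ≡ prefix g k
prefix-cong {zero}  e k       = refl
prefix-cong {suc N} e zero    = refl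
prefix-cong {suc N} e (suc k) = cong₂ _+_ (e zero) (prefix-cong (e ∘ suc) k)

prefix-+ : ∀ {N} (f g : Fin N → ℤ) k → prefix (λ x → f x + g x) k ≡ prefix f k + prefix g k
prefix-+ {zero}  f g k       = refl
prefix-+ {suc N} f g zero    = refl
prefix-+ {suc N} f g (suc k) = trans (cong (λ s → f zero + g zero + s) (prefix-+ (f ∘ suc) (g ∘ suc) k))
  (arith (f zero) (g zero) (prefix (f ∘ suc) k) (prefix (g ∘ suc) k))
  where
  arith : ∀ a b c d → a + b + (c + d) ≡ a + c + (b + d)
  arith = solve-∀

prefix-one : ∀ {N k} → k ℕ.≤ N → prefix {N} (λ _ → + 1) k ≡ + k
prefix-one {zero}  z≤n     = refl
prefix-one {suc N} z≤n     = refl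
prefix-one {suc N} (s≤s h) = cong (λ s → + 1 + s) (prefix-one h)

sum-lt : ∀ {N k} → k ℕ.≤ N → sum {N} (λ i → lt (toℕ i) k) ≡ + k
sum-lt {N} {k} k≤N = trans (sum-cong λ i → sym (ℤ.*-identityʳ (lt (toℕ i) k)))
  (trans (sym (prefix-sum {N} (λ _ → + 1) k)) (prefix-one k≤N))

module Optimal (m n q : ℕ) where

  p d : ℕ
  p = q ℕ.* (m ℕ.* n)
  d = suc q

  -- Position d (n k + b) holds the k-th vertex of the b-th small class and is followed by q big vertices.
  blocks : (Fin (m ℕ.* n) × Fin d) ↔ KVertex p m n
  blocks = mk↔ₛ′ to from to-from from-to
    where
    to : Fin (m ℕ.* n) × Fin d → KVertex p m n
    to (g , zero)  = inj₂ (proj₂ (remQuot {m} n g) , proj₁ (remQuot {m} n g))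
    to (g , suc t) = inj₁ (combine t g)
    from : KVertex p m n → Fin (m ℕ.* n) × Fin d
    from (inj₁ u)       = proj₂ (remQuot {q} (m ℕ.* n) u) , suc (proj₁ (remQuot {q} (m ℕ.* n) u))
    from (inj₂ (b , k)) = combine k b , zero
    to-from : ∀ v → to (from v) ≡ v
    to-from (inj₁ u)       = cong inj₁ (Fin.combine-remQuot {q} (m ℕ.* n) u)
    to-from (inj₂ (b , k)) = cong (λ g → inj₂ (proj₂ g , proj₁ g)) (Fin.remQuot-combine k b)
    from-to : ∀ w → from (to w) ≡ w
    from-to (g , zero)  = cong (_, zero) (Fin.combine-remQuot {m} n g)
    from-to (g , suc t) = cong (λ w → proj₂ w , suc (proj₁ w)) (Fin.remQuot-combine t g)

  length≡ : order p m n ≡ (m ℕ.* n) ℕ.* d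
  length≡ = arith m n q
    where
    arith : ∀ m n q → q ℕ.* (m ℕ.* n) ℕ.+ n ℕ.* m ≡ (m ℕ.* n) ℕ.* (1 ℕ.+ q)
    arith = ℕ-Solver.solve-∀

  drawing : OuterplanarDrawing p m n
  drawing = ↔-trans (cast-id length≡) (↔-trans (Fin.*↔× {m ℕ.* n}) blocks)

  private
    f = Inverse.to drawing
    pos : KVertex p m n → ℕ
    pos v = toℕ (Inverse.from drawing v)

  pos-block : ∀ v → pos v ≡ d ℕ.* toℕ (proj₁ (Inverse.from blocks v)) ℕ.+ toℕ (proj₂ (Inverse.from blocks v))
  pos-block v = trans (Fin.toℕ-cast (sym length≡) _) (Fin.toℕ-combine (proj₁ (Inverse.from blocks v)) (proj₂ (Inverse.from blocks v)))

  -- Mixed-radix coordinates of a position: round `k` through the small classes, block `b` of that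
  -- round, offset `t` in the block. Offset 0 is the small vertex heading the block, and the other
  -- offsets are big vertices.
  record Place (v : KVertex p m n) : Set where
    field
      k        : Fin m
      b        : Fin n
      t        : ℕ
      t<d      : t ℕ.< d
      at       : pos v ≡ d ℕ.* (n ℕ.* toℕ k ℕ.+ toℕ b) ℕ.+ t
      of-rest  : rest v ≡ + 1 → t ≡ 0
      of-small : ∀ A → small A v ≡ + 1 → b ≡ A × t ≡ 0

  place : ∀ v → Place v
  place (inj₂ (b , k)) = record
    { k = k ; b = b ; t = 0 ; t<d = s≤s z≤n
    ; at = trans (pos-block (inj₂ (b , k))) (cong (λ g → d ℕ.* g ℕ.+ 0) (Fin.toℕ-combine k b))
    ; of-rest = λ _ → refl
    ; of-small = λ A → same A
    }
    where
    same : ∀ A → δ b A ≡ + 1 → b ≡ A × 0 ≡ 0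
    same A with b ≟ A
    ... | yes b≡A = λ _ → b≡A , refl
    ... | no  _   = λ ()
  place (inj₁ u) = record
    { k = proj₁ kb ; b = proj₂ kb ; t = suc (toℕ (proj₁ tg)) ; t<d = s≤s (Fin.toℕ<n (proj₁ tg))
    ; at = trans (pos-block (inj₁ u)) (cong (λ g → d ℕ.* g ℕ.+ suc (toℕ (proj₁ tg)))
             (trans (cong toℕ (sym (Fin.combine-remQuot {m} n (proj₂ tg)))) (Fin.toℕ-combine (proj₁ kb) (proj₂ kb))))
    ; of-rest = λ ()
    ; of-small = λ _ ()
    }
    where
    tg = remQuot {q} (m ℕ.* n) u
    kb = remQuot {m} n (proj₂ tg)

  private
    p≡ : + p ≡ + q * (+ n * + m)
    p≡ = trans (ℤ.pos-* q (m ℕ.* n)) (cong (+ q *_) (trans (cong +_ (ℕ.*-comm m n)) (ℤ.pos-* n m)))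

  open Identity (+ q) p≡ drawing public

  prefix-positions : ∀ (g : KVertex p m n → ℤ) K → prefix (g ∘ f) K
    ≡ sum (λ i → lt (pos (inj₁ i)) K * g (inj₁ i)) + sum (λ a → sum λ i → lt (pos (inj₂ (a , i))) K * g (inj₂ (a , i)))
  prefix-positions g K = trans (prefix-sum (g ∘ f) K) (trans
    (sum-cong λ x → cong (λ y → lt (toℕ y) K * g (f x)) (sym (Inverse.strictlyInverseʳ drawing x)))
    (sum-vertices drawing (λ v → lt (pos v) K * g v)))

  -- The indicator that, within one round through the small classes, A comes before offset t of block b.
  before : Fin n → ∀ {v} → Place v → ℤ
  before A pl = lt (d ℕ.* toℕ A) (d ℕ.* toℕ (Place.b pl) ℕ.+ Place.t pl)

  -- Each completed round contains exactly one vertex of `A`, and `before` settles the current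
  -- round.
  prefix-α : ∀ A {v} (pl : Place v) → prefix (α A) (pos v) ≡ + toℕ (Place.k pl) + before A pl
  prefix-α A {v} pl = begin
    prefix (α A) (pos v)
      ≡⟨ prefix-positions (small A) (pos v) ⟩
    sum (λ i → lt (pos (inj₁ i)) (pos v) * + 0) + sum (λ a → sum λ i → lt (pos (inj₂ (a , i))) (pos v) * δ a A)
      ≡⟨ cong₂ _+_ (trans (sum-cong λ i → ℤ.*-zeroʳ (lt (pos (inj₁ i)) (pos v))) (sum-zero p))
           (trans (sum-cong λ a → trans (sym (sum-*ʳ (δ a A) _)) (trans (ℤ.*-comm _ (δ a A)) (cong (_* sum (λ i → lt (pos (inj₂ (a , i))) (pos v))) (δ-sym a A))))
             (sum-δ A (λ a → sum λ i → lt (pos (inj₂ (a , i))) (pos v)))) ⟩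
    + 0 + sum (λ i → lt (pos (inj₂ (A , i))) (pos v))
      ≡⟨ trans (ℤ.+-identityˡ _) (sum-cong λ i → trans (cong₂ lt (Place.at (place (inj₂ (A , i)))) at) (compare i)) ⟩
    sum (λ i → lt (toℕ i) (toℕ k) + δ k i * before A pl)
      ≡⟨ trans (sum-+ (λ i → lt (toℕ i) (toℕ k)) _) (cong₂ _+_ (sum-lt (ℕ.<⇒≤ (Fin.toℕ<n k))) (sum-δ k (λ _ → before A pl))) ⟩
    + toℕ k + before A pl ∎
    where
    open Place pl
    compare : ∀ i → lt (d ℕ.* (n ℕ.* toℕ i ℕ.+ toℕ A) ℕ.+ 0) (d ℕ.* (n ℕ.* toℕ k ℕ.+ toℕ b) ℕ.+ t)
      ≡ lt (toℕ i) (toℕ k) + δ k i * before A pl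
    compare i with k ≟ i
    ... | yes refl = trans
      (cong₂ lt (shift d (n ℕ.* toℕ k) (toℕ A)) (ℕ-arith d (n ℕ.* toℕ k) (toℕ b) t))
      (trans (lt-+ˡ (d ℕ.* (n ℕ.* toℕ k)) (d ℕ.* toℕ A) (d ℕ.* toℕ b ℕ.+ t))
        (trans (sym (ℤ.*-identityˡ (before A pl))) (trans (sym (ℤ.+-identityˡ (+ 1 * before A pl)))
          (cong (_+ + 1 * before A pl) (sym (lt-false (ℕ.n≮n (toℕ k))))))))
      where
      shift : ∀ d x a → d ℕ.* (x ℕ.+ a) ℕ.+ 0 ≡ d ℕ.* x ℕ.+ d ℕ.* a
      shift = ℕ-Solver.solve-∀
      ℕ-arith : ∀ d x b t → d ℕ.* (x ℕ.+ b) ℕ.+ t ≡ d ℕ.* x ℕ.+ (d ℕ.* b ℕ.+ t)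
      ℕ-arith = ℕ-Solver.solve-∀
    ... | no k≢i with ℕ.<-cmp (toℕ i) (toℕ k)
    ...   | tri< i<k _ _ = trans (lt-true (lex-< {d} t (s≤s z≤n) (lex-< {n} (toℕ b) (Fin.toℕ<n A) i<k)))
                             (sym (trans (cong (λ l → l + + 0 * before A pl) (lt-true i<k)) (arith (before A pl))))
      where
      arith : ∀ x → + 1 + + 0 * x ≡ + 1
      arith = solve-∀
    ...   | tri≈ _ i≡k _ = ⊥-elim (k≢i (sym (Fin.toℕ-injective i≡k)))
    ...   | tri> i≮k _ k<i = trans (lt-false (ℕ.<-asym (lex-< {d} 0 t<d (lex-< {n} (toℕ A) (Fin.toℕ<n b) k<i))))
                             (sym (trans (cong (λ l → l + + 0 * before A pl) (lt-false i≮k)) (arith (before A pl))))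
      where
      arith : ∀ x → + 0 + + 0 * x ≡ + 0
      arith = solve-∀

  private
    at-x : ∀ x → pos (f x) ≡ toℕ x
    at-x x = cong toℕ (Inverse.strictlyInverseʳ drawing x)

    k[_] : Fin (order p m n) → ℤ
    k[ x ] = + toℕ (Place.k (place (f x)))

    θ : Fin n → Fin (order p m n) → ℤ
    θ A x = before A (place (f x))

    prefix-at : ∀ A x → prefix (α A) (toℕ x) ≡ k[ x ] + θ A x
    prefix-at A x = trans (cong (prefix (α A)) (sym (at-x x))) (prefix-α A (place (f x)))

    lt-scale : ∀ a b → lt (d ℕ.* a) (d ℕ.* b ℕ.+ 0) ≡ lt a b
    lt-scale a b = trans (cong (λ x → lt x (d ℕ.* b ℕ.+ 0)) (sym (ℕ.+-identityʳ (d ℕ.* a)))) (go (ℕ.<-cmp a b))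
      where
      go : _ → lt (d ℕ.* a ℕ.+ 0) (d ℕ.* b ℕ.+ 0) ≡ lt a b
      go (tri< a<b _ _)    = trans (lt-true (lex-< {d} 0 (s≤s z≤n) a<b)) (sym (lt-true a<b))
      go (tri≈ a≮b refl _) = trans (lt-false (ℕ.n≮n (d ℕ.* a ℕ.+ 0))) (sym (lt-false a≮b))
      go (tri> a≮b _ b<a)  = trans (lt-false (ℕ.<-asym (lex-< {d} 0 (s≤s z≤n) b<a))) (sym (lt-false a≮b))

    θ-head : ∀ B x → Place.t (place (f x)) ≡ 0 → θ B x ≡ lt (toℕ B) (toℕ (Place.b (place (f x))))
    θ-head B x t≡0 = trans (cong (λ t → lt (d ℕ.* toℕ B) (d ℕ.* toℕ (Place.b (place (f x))) ℕ.+ t)) t≡0)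
      (lt-scale (toℕ B) (toℕ (Place.b (place (f x)))))

    θ-small : ∀ A B x → α A x ≡ + 1 → θ B x ≡ lt (toℕ B) (toℕ A)
    θ-small A B x αx≡1 with Place.of-small (place (f x)) A αx≡1
    ... | b≡A , t≡0 = trans (θ-head B x t≡0) (cong (λ b → lt (toℕ B) (toℕ b)) b≡A)

    -- Within a round the classes appear in the order of their indices, so whoever has passed `B`
    -- has passed `A`.
    θ-monotone : ∀ A B x → toℕ A ℕ.≤ toℕ B → Bit (θ A x - θ B x)
    θ-monotone A B x A≤B = go (d ℕ.* toℕ B ℕ.<? z)
      where
      z = d ℕ.* toℕ (Place.b (place (f x))) ℕ.+ Place.t (place (f x))
      go : _ → Bit (θ A x - θ B x)
      go (yes B<z) = inj₁ (cong₂ _-_ (lt-true (ℕ.≤-<-trans (ℕ.*-monoʳ-≤ d A≤B) B<z)) (lt-true B<z))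
      go (no  B≮z) = subst Bit (trans (sym (ℤ.+-identityʳ (θ A x))) (cong (λ s → θ A x - s) (sym (lt-false B≮z))))
                       (lt-bit (d ℕ.* toℕ A) z)

    excess-at : ∀ A B x → excess (α A) (α B) x ≡ θ B x - θ A x
    excess-at A B x = trans (cong₂ _-_ (prefix-at B x) (prefix-at A x)) (arith k[ x ] (θ B x) (θ A x))
      where
      arith : ∀ k x y → k + x - (k + y) ≡ x - y
      arith = solve-∀

    gap-zero : ∀ {e b} → Bit e → Bit b → (b ≡ + 1 → e ≡ + 1) → (e - + 1) * (e - b) ≡ + 0
    gap-zero (inj₂ refl) bit-b       _ = refl
    gap-zero (inj₁ refl) (inj₁ refl) _ = refl
    gap-zero (inj₁ refl) (inj₂ refl) h with () ← h refl

    -- Round numbers cancel in the excess, so `e` consists of comparisons inside a round and is 0 or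
    -- 1. The product could then be nonzero only for e = 0 with `c` in `B`, and `at-B` rules this
    -- out.
    gap-vanishes : ∀ A B c y → α A c ≡ + 0 → α A y ≡ + 1 →
      (excess (α A) (α B) y - excess (α A) (α B) c - + 1) * (excess (α A) (α B) y - excess (α A) (α B) c - α B c) ≡ + 0
    gap-vanishes A B c y αc≡0 αy≡1 = trans
      (cong (λ e → (e - + 1) * (e - α B c)) e≡) (gap-zero (bit (ℕ.<-cmp (toℕ A) (toℕ B))) (small-bit B (f c)) at-B)
      where
      a = toℕ A
      b = toℕ B
      e : ℤ
      e = lt b a - (θ B c - θ A c)
      e≡ : excess (α A) (α B) y - excess (α A) (α B) c ≡ e
      e≡ = cong₂ _-_ (trans (excess-at A B y) (trans (cong₂ _-_ (θ-small A B y αy≡1) (trans (θ-small A A y αy≡1) (lt-false (ℕ.n≮n a))))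
             (ℤ.+-identityʳ (lt b a)))) (excess-at A B c)
      bit : _ → Bit e
      bit (tri< a<b _ b≮a) = subst Bit (trans (arith (θ A c) (θ B c)) (cong (_- (θ B c - θ A c)) (sym (lt-false b≮a)))) (θ-monotone A B c (ℕ.<⇒≤ a<b))
        where
        arith : ∀ x y → x - y ≡ + 0 - (y - x)
        arith = solve-∀
      bit (tri≈ _ a≡b _) with Fin.toℕ-injective a≡b
      ... | refl = inj₁ (trans (cong (_- (θ A c - θ A c)) (lt-false (ℕ.n≮n a))) (arith (θ A c)))
        where
        arith : ∀ x → + 0 - (x - x) ≡ + 0
        arith = solve-∀
      bit (tri> _ _ b<a) = subst Bit (cong (_- (θ B c - θ A c)) (sym (lt-true b<a))) (flip (θ-monotone B A c (ℕ.<⇒≤ b<a)))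
        where
        flip : ∀ {x} → Bit x → Bit (+ 1 - x)
        flip (inj₁ refl) = inj₂ refl
        flip (inj₂ refl) = inj₁ refl
      at-B : α B c ≡ + 1 → e ≡ + 1
      at-B βc≡1 = trans (cong₂ (λ x y → lt b a - (x - y)) (trans (θ-small B B c βc≡1) (lt-false (ℕ.n≮n b))) (trans (θ-small B A c βc≡1) (lt-swap b≢a)))
        (arith (lt b a))
        where
        b≢a : b ≢ a
        b≢a b≡a with Fin.toℕ-injective b≡a
        ... | refl with () ← trans (sym αc≡0) βc≡1
        arith : ∀ x → x - (+ 0 - (+ 1 - x)) ≡ + 1
        arith = solve-∀

    on-bit : ∀ {x} → Bit x → ∀ {y} → (x ≡ + 1 → y ≡ + 0) → x * y ≡ + 0
    on-bit (inj₁ refl) {y} _ = ℤ.*-zeroˡ y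
    on-bit (inj₂ refl) {y} h = trans (ℤ.*-identityˡ y) (h refl)

    sum-vanishes : ∀ {N} {g : Fin N → ℤ} → (∀ i → g i ≡ + 0) → sum g ≡ + 0
    sum-vanishes {N} h = trans (sum-cong h) (sum-zero N)

  disorder-vanishes : ∑² disorder ≡ + 0
  disorder-vanishes = sum-vanishes λ A → sum-vanishes λ B → sum-vanishes λ c →
    trans (on-weight A c λ αc≡0 → sum-vanishes λ y →
      trans (cong (distinct c y *_) (on-bit (small-bit A (f y)) (gap-vanishes A B c y αc≡0))) (ℤ.*-zeroʳ (distinct c y)))
      (ℤ.*-zeroʳ (weight A c))

  private
    prefix-sum-α : ∀ k → prefix ρ k ≡ sum λ A → prefix (α A) k
    prefix-sum-α k = begin
      prefix ρ k
        ≡⟨ trans (prefix-sum ρ k) (sum-cong λ y → trans (cong (lt (toℕ y) k *_) (sym (sum-small (f y)))) (sum-*ˡ (lt (toℕ y) k) (λ A → α A y))) ⟩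
      sum (λ y → sum λ A → lt (toℕ y) k * α A y)
        ≡⟨ trans (sum-comm (λ y A → lt (toℕ y) k * α A y)) (sum-cong λ A → sym (prefix-sum (α A) k)) ⟩
      sum (λ A → prefix (α A) k) ∎

    -- A vertex outside the big class heads its block, so only whole blocks precede it, each with
    -- one small vertex and q big ones.
    drift-vanishes : ∀ x → ρ x ≡ + 1 → drift ρ π (+ q) x ≡ + 0
    drift-vanishes x ρx≡1 = trans
      (arith (+ q) (prefix ρ (toℕ x)) (prefix π (toℕ x)))
      (trans (cong₂ _-_ total (cong ((+ 1 + + q) *_) count)) (ℤ.i≡j⇒i-j≡0 position))
      where
      open Place (place (f x))
      arith : ∀ q r p → p - q * r ≡ p + r - (+ 1 + q) * r
      arith = solve-∀
      total : prefix π (toℕ x) + prefix ρ (toℕ x) ≡ + toℕ x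
      total = trans (sym (prefix-+ π ρ (toℕ x))) (trans (prefix-cong (λ y → one (f y)) (toℕ x)) (prefix-one (ℕ.<⇒≤ (Fin.toℕ<n x))))
        where
        one : ∀ (v : KVertex p m n) → big v + rest v ≡ + 1
        one (inj₁ _) = refl
        one (inj₂ _) = refl
      count : prefix ρ (toℕ x) ≡ + n * k[ x ] + + toℕ b
      count = begin
        prefix ρ (toℕ x)
          ≡⟨ trans (prefix-sum-α (toℕ x)) (sum-cong λ A → trans (prefix-at A x) (cong (λ s → k[ x ] + s) (θ-head A x (of-rest ρx≡1)))) ⟩
        sum (λ A → k[ x ] + lt (toℕ A) (toℕ b))
          ≡⟨ trans (sum-+ (λ _ → k[ x ]) _) (cong₂ _+_ (sum-const n k[ x ]) (sum-lt (ℕ.<⇒≤ (Fin.toℕ<n b)))) ⟩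
        + n * k[ x ] + + toℕ b ∎
      position : + toℕ x ≡ (+ 1 + + q) * (+ n * k[ x ] + + toℕ b)
      position = begin
        + toℕ x
          ≡⟨ cong +_ (trans (sym (at-x x)) (trans at (cong (λ t → d ℕ.* (n ℕ.* toℕ k ℕ.+ toℕ b) ℕ.+ t) (of-rest ρx≡1)))) ⟩
        + (d ℕ.* (n ℕ.* toℕ k ℕ.+ toℕ b) ℕ.+ 0)
          ≡⟨ cong +_ (ℕ.+-identityʳ _) ⟩
        + (d ℕ.* (n ℕ.* toℕ k ℕ.+ toℕ b))
          ≡⟨ trans (ℤ.pos-* d _) (cong (λ s → + d * (s + + toℕ b)) (ℤ.pos-* n (toℕ k))) ⟩
        (+ 1 + + q) * (+ n * k[ x ] + + toℕ b) ∎

  spread-vanishes : spread ≡ + 0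
  spread-vanishes = sum-vanishes λ c → on-bit (rest-bit (f c)) λ ρc≡1 → sum-vanishes λ y →
    trans (cong (distinct c y *_) (on-bit (rest-bit (f y)) λ ρy≡1 →
      cong₂ (λ u v → (u - v) * (u - v)) (drift-vanishes y ρy≡1) (drift-vanishes c ρc≡1)))
      (ℤ.*-zeroʳ (distinct c y))

  crossings-drawing : + 24 * + crossings {p} {m} {n} drawing ≡ rhs24 m n p
  crossings-drawing = trans crossings-identity (trans
    (cong₂ (λ x y → rhs24 m n p + (+ 12 * x + + 6 * y)) spread-vanishes disorder-vanishes) (ℤ.+-identityʳ (rhs24 m n p)))

  -- Both drawings satisfy the same identity, and for this one the correction is 0. The correction
  -- of `D` is a natural number k, which is the difference of the two sides after multiplication by
  -- 24.
  drawing-optimal : ∀ (D : OuterplanarDrawing p m n) → crossings {p} {m} {n} drawing ℕ.≤ crossings {p} {m} {n} D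
  drawing-optimal D with crossings-excess (+ q) p≡ D
  ... | k , excess≡k = ℕ.*-cancelˡ-≤ 24 (ℕ.m+n≤o⇒m≤o _ (ℕ.≤-reflexive (ℤ.+-injective (begin
    + (24 ℕ.* crossings {p} {m} {n} drawing) + + k
      ≡⟨ cong (_+ + k) (trans (ℤ.pos-* 24 (crossings {p} {m} {n} drawing)) crossings-drawing) ⟩
    rhs24 m n p + + k
      ≡⟨ sym (trans (Identity.crossings-identity (+ q) p≡ D) (cong (λ s → rhs24 m n p + s) excess≡k)) ⟩
    + 24 * + crossings {p} {m} {n} D
      ≡⟨ sym (ℤ.pos-* 24 (crossings {p} {m} {n} D)) ⟩
    + (24 ℕ.* crossings {p} {m} {n} D) ∎))))

theorem2 : (m n p : ℕ) → 1 ≤ m → 1 ≤ n → 1 ≤ p → (m Data.Nat.* n) ∣ p →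
    ∃ λ c → IsOuterplanarCrossingNumber p m n c × (+ 24 * + c ≡ rhs24 m n p)
theorem2 m n _ _ _ _ (divides q refl) =
  crossings {p} {m} {n} drawing , ((drawing , refl) , drawing-optimal) , crossings-drawing
  where open Optimal m n q
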